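{- Let $c>0$ and let $G$ be an $n$-vertex circle graph with $\alpha(G)=cn$, where $n$ is sufficiently large. Then $h(G)\le \frac{4n\log\log n}{\log n}$.
   Context: $\log$ is base $2$. A circle graph has as vertices a finite set of chords of a circle, two adjacent iff the chords cross. $\alpha(G)$ is the independence number. A hitting set of $G$ is a set $T\subseteq V(G)$ meeting every maximum independent set of $G$; $h(G)$ is the minimum size of a hitting set. -}

module Defs where

open import Data.Nat using (ℕ; _<_; _≤_; _*_; _^_)
open import Data.Fin using (Fin)
open import Data.Fin.Subset using (Subset; _∈_; ∣_∣)
open import Data.Product using (_×_; Σ; ∃; ∃-syntax; _,_)
open import Relation.Binary.PropositionalEquality using (_≡_)
open import Relation.Nullary using (¬_)

-- A chord diagram with n chords.  Points of the circle are encoded by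
-- natural numbers (their position in the cyclic order, cut open at an
-- arbitrary point).  Chord i has endpoints left i < right i.
-- The chords form a SET: distinct indices give distinct chords.
record ChordDiagram (n : ℕ) : Set where
  field
    left     : Fin n → ℕ
    right    : Fin n → ℕ
    ordered  : ∀ i → left i < right i
    distinct : ∀ i j → left i ≡ left j → right i ≡ right j → i ≡ j

open ChordDiagram public

Cross : ∀ {n} → ChordDiagram n → Fin n → Fin n → Set
Cross D i j =
  (left D i < left D j × left D j < right D i × right D i < right D j)
  Data.Sum.⊎
  (left D j < left D i × left D i < right D j × right D j < right D i)
  where import Data.Sum

-- The circle graph of D has vertex set Fin n, adjacency = Cross.
Independent : ∀ {n} → ChordDiagram n → Subset n → Set
Independent D S = ∀ i j → i ∈ S → j ∈ S → ¬ Cross D i j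

MaximumIndependent : ∀ {n} → ChordDiagram n → Subset n → Set
MaximumIndependent {n} D S =
  Independent D S × (∀ (S′ : Subset n) → Independent D S′ → ∣ S′ ∣ ≤ ∣ S ∣)

IndependenceNumber : ∀ {n} → ChordDiagram n → ℕ → Set
IndependenceNumber D k = ∃[ S ] (MaximumIndependent D S × ∣ S ∣ ≡ k)

HittingSet : ∀ {n} → ChordDiagram n → Subset n → Set
HittingSet {n} D T =
  ∀ (S : Subset n) → MaximumIndependent D S → ∃[ i ] (i ∈ T × i ∈ S)

-- BoundLogLog n h  encodes the real inequality
--     h ≤ 4 n log₂(log₂ n) / log₂ n     (for n ≥ 2),
-- equivalently  n^h ≤ (log₂ n)^(4n),  equivalently (n^h)^(1/(4n)) ≤ log₂ n,
-- via density of the rationals: every rational p/q (q > 0) with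
-- (p/q)^(4n) < n^h also satisfies p/q < log₂ n, i.e. 2^p < n^q.
BoundLogLog : ℕ → ℕ → Set
BoundLogLog n h =
  ∀ (p q : ℕ) → 0 < q → p ^ (4 * n) < n ^ h * q ^ (4 * n) → 2 ^ p < n ^ q

module Submission where

open import Defs
open import Data.Nat using (ℕ; zero; suc; >-nonZero; _+_; _*_; _^_; _≤_; _<_; z≤n; s≤s; z<s; _≟_; _≤?_; _<?_)
open import Data.Nat.Properties
open import Data.Nat.DivMod using (_/_; _%_; m/n*n≤m; m≡m%n+[m/n]*n; m%n≤n; m≥n⇒m/n>0)
open import Data.Nat.Tactic.RingSolver using (solve-∀)
open import Data.Nat.ListAction using (sum)
open import Data.Fin using (Fin; toℕ) renaming (zero to fzero; suc to fsuc; _≟_ to _≟ᶠ_)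
open import Data.Fin.Properties using (toℕ<n; toℕ-injective) renaming (suc-injective to fsuc-injective; any? to anyᶠ?)
open import Data.Fin.Subset using (Subset; ∣_∣; inside; outside; ⁅_⁆; _∪_; ⊥)
  renaming (_∈_ to _∈ₛ_)
open import Data.Fin.Subset.Properties using (x∈⁅x⁆; x∈⁅y⁆⇒x≡y; x∈p∪q⁺; x∈p∪q⁻; ∉⊥)
open import Data.List using (List; []; _∷_; _++_; length; map; filter; concat; allFin; upTo; cartesianProduct)
open import Data.List.Properties using (length-++; length-map; length-tabulate; length-upTo; length-filter; filter-++; filter-all; filter-none)
open import Data.List.Membership.Propositional using (_∈_; _∉_; find; lose)
open import Data.List.Membership.Propositional.Properties
  using (∈-∃++; ∈-++⁺ˡ; ∈-++⁺ʳ; ∈-++⁻; ∈-map⁺; ∈-map⁻; ∈-filter⁺; ∈-filter⁻; ∈-allFin; ∈-concat⁻′; ∈-upTo⁺; ∈-cartesianProduct⁺; ∈-length; ∈-AllPairs₂)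
open import Data.List.Relation.Unary.Any using (here; there; any?)
open import Data.List.Relation.Unary.All as All using (All; []; _∷_)
open import Data.List.Relation.Unary.AllPairs as AllPairs using (AllPairs; []; _∷_)
import Data.List.Relation.Unary.AllPairs.Properties as AllPairsₚ
open import Data.List.Relation.Unary.Unique.Propositional using (Unique)
import Data.List.Relation.Unary.Unique.Propositional.Properties as Uniqueₚ
open import Data.List.Relation.Binary.Disjoint.Propositional using (Disjoint)
open import Data.Vec using (Vec; []; _∷_; lookup; head; tail; here; there)
open import Data.Product using (_×_; _,_; ∃; ∃₂; ∃-syntax; proj₁; proj₂)
open import Data.Sum using (_⊎_; inj₁; inj₂; [_,_]′)
open import Data.Empty using (⊥-elim)
open import Function using (_∘_; id; _on_)
open import Relation.Nullary using (¬_; Dec; yes; no; contradiction)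
open import Relation.Nullary.Decidable using (¬?; _×-dec_)
open import Relation.Unary using (Decidable)
open import Relation.Binary.PropositionalEquality
  using (_≡_; _≢_; refl; sym; trans; cong; cong₂; subst; subst₂)

-- Cut the circle greedily into segments containing no chord. If this takes more than log n cuts,
-- the chords found along the way have disjoint spans, so one of them has small degree, and its closed
-- neighbourhood meets every maximum independent set S. Otherwise, as S is linear in size, some pair of
-- segments is joined by n / polylog n chords of S that are a constant fraction of all chords joining it.
-- They form a nested chain, from o to c say, and the chords lying between o and c split, by height in
-- the nesting order, into cliques, every one of which S must meet; many of these have bounded size. So
-- it suffices that T contains, for each of the at most n² pairs (o, c) with at least polylog n bounded
-- cliques, one of those cliques.
-- A greedy cover, iterated once per element of a clique, yields such a T of size at most 4n / (1 + log n).

-- Counting in lists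

positive-factor : ∀ a b {q} → q < a * b → 0 < b
positive-factor a zero    lt = contradiction (<-≤-trans lt (≤-reflexive (*-zeroʳ a))) n≮0
positive-factor a (suc b) _  = z<s

length-unique-≤ : ∀ {A : Set} {xs ys : List A} → Unique xs →
  (∀ {x} → x ∈ xs → x ∈ ys) → length xs ≤ length ys
length-unique-≤ {xs = []} _ _ = z≤n
length-unique-≤ {xs = x ∷ xs} {ys} (x∉ ∷ u) sub with ∈-∃++ (sub (here refl))
... | as , bs , refl = begin
  suc (length xs)               ≤⟨ s≤s (length-unique-≤ u sub′) ⟩
  suc (length (as ++ bs))       ≡⟨ cong suc (length-++ as) ⟩
  suc (length as + length bs)   ≡⟨ sym (+-suc (length as) (length bs)) ⟩
  length as + suc (length bs)   ≡⟨ sym (length-++ as) ⟩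
  length (as ++ x ∷ bs)         ∎
  where
  open ≤-Reasoning
  sub′ : ∀ {y} → y ∈ xs → y ∈ as ++ bs
  sub′ y∈ with ∈-++⁻ as (sub (there y∈))
  ... | inj₁ y∈as = ∈-++⁺ˡ y∈as
  ... | inj₂ (here refl) = contradiction refl (All.lookup x∉ y∈)
  ... | inj₂ (there y∈bs) = ∈-++⁺ʳ as y∈bs

length-allFin : ∀ n → length (allFin n) ≡ n
length-allFin n = length-tabulate id

length-unique-Fin : ∀ {n} {xs : List (Fin n)} → Unique xs → length xs ≤ n
length-unique-Fin {n} u =
  ≤-trans (length-unique-≤ u (λ _ → ∈-allFin _)) (≤-reflexive (length-allFin n))

nonempty-∈ : ∀ {A : Set} {xs : List A} → 0 < length xs → ∃ (_∈ xs)
nonempty-∈ {xs = x ∷ _} _ = x , here refl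

length-cartesianProduct : ∀ {A B : Set} (xs : List A) (ys : List B) →
  length (cartesianProduct xs ys) ≡ length xs * length ys
length-cartesianProduct []       ys = refl
length-cartesianProduct (x ∷ xs) ys = trans (length-++ (map (x ,_) ys))
  (cong₂ _+_ (length-map (x ,_) ys) (length-cartesianProduct xs ys))

allPairs-∈ : ∀ {A : Set} {R : A → A → Set} {xs : List A} → Unique xs →
  (∀ {x y} → x ∈ xs → y ∈ xs → x ≢ y → R x y) → AllPairs R xs
allPairs-∈ [] _ = []
allPairs-∈ {xs = x ∷ xs} (x∉ ∷ u) r =
  All.tabulate (λ y∈ → r (here refl) (there y∈) (All.lookup x∉ y∈))
  ∷ allPairs-∈ u (λ x∈ y∈ → r (there x∈) (there y∈))

unique-map : ∀ {A B : Set} (f : A → B) {xs : List A} → Unique xs →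
  (∀ {x y} → x ∈ xs → y ∈ xs → f x ≡ f y → x ≡ y) → Unique (map f xs)
unique-map f u inj =
  AllPairsₚ.map⁺ (allPairs-∈ u (λ x∈ y∈ x≢y fx≡fy → x≢y (inj x∈ y∈ fx≡fy)))

unique-concat-map : ∀ {A B : Set} (f : A → List B) {xs : List A} →
  (∀ x → Unique (f x)) → AllPairs (Disjoint on f) xs → Unique (concat (map f xs))
unique-concat-map f {xs} u d =
  Uniqueₚ.concat⁺ (All.tabulate (λ y∈ → lemma y∈)) (AllPairsₚ.map⁺ d)
  where
  lemma : ∀ {ys} → ys ∈ map f xs → Unique ys
  lemma y∈ with ∈-map⁻ f y∈
  ... | x , _ , refl = u x

length-concat-map : ∀ {A B : Set} (f : A → List B) (xs : List A) →
  length (concat (map f xs)) ≡ sum (map (length ∘ f) xs)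
length-concat-map f [] = refl
length-concat-map f (x ∷ xs) =
  trans (length-++ (f x)) (cong (length (f x) +_) (length-concat-map f xs))

length-concat-map-≥ : ∀ {A B : Set} (f : A → List B) {u : ℕ} (xs : List A) →
  (∀ {x} → x ∈ xs → u ≤ length (f x)) → length xs * u ≤ length (concat (map f xs))
length-concat-map-≥ f [] _ = z≤n
length-concat-map-≥ f (x ∷ xs) h =
  ≤-trans (+-mono-≤ (h (here refl)) (length-concat-map-≥ f xs (h ∘ there)))
          (≤-reflexive (sym (length-++ (f x))))

module _ {A : Set} {P Q : A → Set} (P? : Decidable P) (Q? : Decidable Q) where

  length-filter-mono : ∀ xs → (∀ {x} → x ∈ xs → P x → Q x) →
    length (filter P? xs) ≤ length (filter Q? xs)
  length-filter-mono [] _ = z≤n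
  length-filter-mono (x ∷ xs) h with P? x | Q? x
  ... | yes p | yes q = s≤s (length-filter-mono xs (h ∘ there))
  ... | yes p | no ¬q = contradiction (h (here refl) p) ¬q
  ... | no _  | yes q = m≤n⇒m≤1+n (length-filter-mono xs (h ∘ there))
  ... | no _  | no _  = length-filter-mono xs (h ∘ there)

  length-filter-mono-< : ∀ {xs x} → (∀ {y} → y ∈ xs → P y → Q y) → x ∈ xs → ¬ P x → Q x →
    length (filter P? xs) < length (filter Q? xs)
  length-filter-mono-< {y ∷ xs} h x∈ ¬p q with P? y | Q? y | x∈
  ... | yes p | _     | here refl = contradiction p ¬p
  ... | no _  | yes _ | here refl = s≤s (length-filter-mono xs (h ∘ there))
  ... | no _  | no ¬q | here refl = contradiction q ¬q
  ... | yes p | yes _ | there x∈′ = s≤s (length-filter-mono-< (h ∘ there) x∈′ ¬p q)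
  ... | yes p | no ¬q | there _   = contradiction (h (here refl) p) ¬q
  ... | no _  | yes _ | there x∈′ = m≤n⇒m≤1+n (length-filter-mono-< (h ∘ there) x∈′ ¬p q)
  ... | no _  | no _  | there x∈′ = length-filter-mono-< (h ∘ there) x∈′ ¬p q

length-filter-¬ : ∀ {A : Set} {P : A → Set} (P? : Decidable P) xs →
  length (filter P? xs) + length (filter (¬? ∘ P?) xs) ≡ length xs
length-filter-¬ P? [] = refl
length-filter-¬ P? (x ∷ xs) with P? x
... | yes _ = cong suc (length-filter-¬ P? xs)
... | no _  = trans (+-suc _ _) (cong suc (length-filter-¬ P? xs))

module _ {A : Set} {P Q R : A → Set} (P? : Decidable P) (Q? : Decidable Q) (R? : Decidable R) where

  length-filter-⊎ : ∀ xs → (∀ {x} → P x → Q x ⊎ R x) → (∀ {x} → Q x → P x) →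
    (∀ {x} → R x → P x) → (∀ {x} → Q x → ¬ R x) →
    length (filter P? xs) ≡ length (filter Q? xs) + length (filter R? xs)
  length-filter-⊎ [] _ _ _ _ = refl
  length-filter-⊎ (x ∷ xs) P⇒Q⊎R Q⇒P R⇒P Q⇒¬R
    with ih ← length-filter-⊎ xs P⇒Q⊎R Q⇒P R⇒P Q⇒¬R | P? x | Q? x | R? x
  ... | yes _ | yes q | yes r = contradiction r (Q⇒¬R q)
  ... | yes _ | yes _ | no _  = cong suc ih
  ... | yes _ | no _  | yes _ = trans (cong suc ih) (sym (+-suc _ _))
  ... | yes p | no ¬q | no ¬r = contradiction (P⇒Q⊎R p) [ ¬q , ¬r ]′
  ... | no ¬p | yes q | _     = contradiction (Q⇒P q) ¬p
  ... | no ¬p | no _  | yes r = contradiction (R⇒P r) ¬p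
  ... | no _  | no _  | no _  = ih

module _ {A : Set} (f : A → ℕ) where

  fibre : ℕ → List A → List A
  fibre i = filter (λ x → f x ≟ i)

  below : ℕ → List A → List A
  below t = filter (λ x → f x <? t)

  length-below-suc : ∀ t xs →
    length (below (suc t) xs) ≡ length (fibre t xs) + length (below t xs)
  length-below-suc t xs = length-filter-⊎ (λ x → f x <? suc t) (λ x → f x ≟ t) (λ x → f x <? t) xs
    (λ l → [ (λ fx<t → inj₂ fx<t) , inj₁ ]′ (m≤n⇒m<n∨m≡n (≤-pred l)))
    (λ e → s≤s (≤-reflexive e)) m<n⇒m<1+n (λ e l → <⇒≢ l e)

  length-below-all : ∀ t xs → (∀ {x} → x ∈ xs → f x < t) → length (below t xs) ≡ length xs
  length-below-all t xs h = cong length (filter-all (λ x → f x <? t) (All.tabulate h))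

  -- Averaging with slack: if `c * length (fibre i ws) ≤ length (fibre i vs) +
  -- q` held for every `i` below `t`, summation would contradict the hypothesis. The `q` paid per
  -- value makes the fibre found large as well as dense.
  dense-fibre-below : ∀ t c q (vs ws : List A) →
    length (below t vs) + t * q < c * length (below t ws) →
    ∃[ i ] length (fibre i vs) + q < c * length (fibre i ws)
  dense-fibre-below zero c q vs ws lt = contradiction (subst (0 <_) eq (≤-<-trans z≤n lt)) λ()
    where
    none : length (below 0 ws) ≡ 0
    none = cong length (filter-none (λ x → f x <? 0) {ws} (All.tabulate (λ _ → n≮0)))
    eq : c * length (below 0 ws) ≡ 0
    eq = trans (cong (c *_) none) (*-zeroʳ c)
  dense-fibre-below (suc t) c q vs ws lt with length (fibre t vs) + q <? c * length (fibre t ws)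
  ... | yes p = t , p
  ... | no ¬p = dense-fibre-below t c q vs ws (+-cancelˡ-< (length (fibre t vs) + q) _ _ (begin-strict
      (length (fibre t vs) + q) + (length (below t vs) + t * q)
        ≡⟨ arith (length (fibre t vs)) q (length (below t vs)) (t * q) ⟩
      (length (fibre t vs) + length (below t vs)) + (q + t * q)
        ≡⟨ cong (_+ (q + t * q)) (sym (length-below-suc t vs)) ⟩
      length (below (suc t) vs) + suc t * q
        <⟨ lt ⟩
      c * length (below (suc t) ws)
        ≡⟨ cong (c *_) (length-below-suc t ws) ⟩
      c * (length (fibre t ws) + length (below t ws))
        ≡⟨ *-distribˡ-+ c (length (fibre t ws)) _ ⟩
      c * length (fibre t ws) + c * length (below t ws)
        ≤⟨ +-monoˡ-≤ _ (≮⇒≥ ¬p) ⟩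
      (length (fibre t vs) + q) + c * length (below t ws) ∎))
    where
    open ≤-Reasoning
    arith : ∀ a b c d → (a + b) + (c + d) ≡ (a + c) + (b + d)
    arith = solve-∀

  dense-fibre : ∀ t c q (vs ws : List A) →
    (∀ {x} → x ∈ vs → f x < t) → (∀ {x} → x ∈ ws → f x < t) →
    length vs + t * q < c * length ws →
    ∃[ i ] length (fibre i vs) + q < c * length (fibre i ws)
  dense-fibre t c q vs ws hv hw lt = dense-fibre-below t c q vs ws
    (subst₂ (λ a b → a + t * q < c * b)
      (sym (length-below-all t vs hv)) (sym (length-below-all t ws hw)) lt)

below-average : ∀ {A : Set} (d : A → ℕ) (xs : List A) → 0 < length xs →
  ∃[ x ] (x ∈ xs × length xs * d x ≤ sum (map d xs))
below-average d (x ∷ []) _ = x , here refl , ≤-refl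
below-average d (x ∷ xs@(_ ∷ _)) _ with below-average d xs z<s
... | y , y∈ , le with ≤-total (d x) (d y)
... | inj₁ dx≤dy = x , here refl ,
      +-monoʳ-≤ (d x) (≤-trans (*-monoʳ-≤ (length xs) dx≤dy) le)
... | inj₂ dy≤dx = y , there y∈ , +-mono-≤ dy≤dx le

-- Hitting many large families of small sets

infix 4 _∈?_

_∈?_ : ∀ {n} (x : Fin n) (xs : List (Fin n)) → Dec (x ∈ xs)
x ∈? xs = any? (x ≟ᶠ_) xs

Large : ∀ {n} → ℕ → List (Fin n) → Set
Large u E = Unique E × u ≤ length E

-- Without repetitions inside the members of `𝓔`, each member contributes at most one copy of `x`.
length-fibre-concat : ∀ {n} (x : Fin n) (𝓔 : List (List (Fin n))) →
  (∀ {E} → E ∈ 𝓔 → Unique E) →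
  length (fibre toℕ (toℕ x) (concat 𝓔)) ≤ length (filter (x ∈?_) 𝓔)
length-fibre-concat x [] _ = z≤n
length-fibre-concat x (E ∷ 𝓔) u
  rewrite filter-++ (λ y → toℕ y ≟ toℕ x) E (concat 𝓔)
        | length-++ (fibre toℕ (toℕ x) E) {fibre toℕ (toℕ x) (concat 𝓔)}
  with x ∈? E | length-fibre-concat x 𝓔 (u ∘ there)
... | yes _ | ih = +-mono-≤ {y = 1} (length-unique-≤ {ys = x ∷ []} fibre-unique (here ∘ ∈fibre)) ih
  where
  fibre-unique : Unique (fibre toℕ (toℕ x) E)
  fibre-unique = Uniqueₚ.filter⁺ _ (u (here refl))
  ∈fibre : ∀ {y} → y ∈ fibre toℕ (toℕ x) E → y ≡ x
  ∈fibre y∈ = toℕ-injective (proj₂ (∈-filter⁻ (λ y → toℕ y ≟ toℕ x) {xs = E} y∈))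
... | no x∉ | ih = +-mono-≤ {y = 0} (≤-reflexive
        (cong length (filter-none (λ y → toℕ y ≟ toℕ x) {E} (All.tabulate λ y∈ e →
          x∉ (subst (_∈ E) (toℕ-injective e) y∈))))) ih

-- Double counting: the concatenation has at least `length 𝓔 * u` entries but only `n` possible
-- values, so some value occurs at least `length 𝓔 * u / n` times.
popular-element : ∀ {n} ρ u (𝓔 : List (List (Fin n))) → 0 < u → 0 < ρ → n ≤ ρ * u →
  (∀ {E} → E ∈ 𝓔 → Large u E) → 0 < length 𝓔 →
  ∃[ x ] length 𝓔 ≤ ρ * length (filter (x ∈?_) 𝓔)
popular-element {n} ρ@(suc _) u@(suc _) 𝓔@(_ ∷ 𝓔′) _ _ n≤ρu large _
  -- Only the slack matters here, so the comparison list is empty. Taking `length 𝓔′`, one less than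
  -- `length 𝓔`, turns the strict conclusion into the bound wanted.
  with dense-fibre toℕ n ρ (length 𝓔′) [] (concat 𝓔) (λ ()) (λ {x} _ → toℕ<n x) (begin-strict
    n * length 𝓔′             ≤⟨ *-monoˡ-≤ (length 𝓔′) n≤ρu ⟩
    ρ * u * length 𝓔′         ≡⟨ trans (*-assoc ρ u _) (cong (ρ *_) (*-comm u _)) ⟩
    ρ * (length 𝓔′ * u)       <⟨ *-monoʳ-< ρ (*-monoˡ-< u (n<1+n (length 𝓔′))) ⟩
    ρ * (length 𝓔 * u)        ≤⟨ *-monoʳ-≤ ρ concat-large ⟩
    ρ * length (concat 𝓔)     ∎)
  where
  open ≤-Reasoning
  concat-large : length 𝓔 * u ≤ length (concat 𝓔)
  concat-large = go 𝓔 (proj₂ ∘ large)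
    where
    go : ∀ (𝓔 : List (List (Fin n))) → (∀ {E} → E ∈ 𝓔 → u ≤ length E) →
      length 𝓔 * u ≤ length (concat 𝓔)
    go [] _ = z≤n
    go (E ∷ 𝓔) h = ≤-trans (+-mono-≤ (h (here refl)) (go 𝓔 (h ∘ there)))
                     (≤-reflexive (sym (length-++ E)))
... | i , dense with fibre toℕ i (concat 𝓔) in eq
...   | [] = contradiction (<-≤-trans dense (≤-reflexive (*-zeroʳ ρ))) n≮0
...   | x ∷ _ with proj₂ (∈-filter⁻ (λ y → toℕ y ≟ i) {xs = concat 𝓔} (subst (x ∈_) (sym eq) (here refl)))
...     | refl = x , ≤-trans dense (*-monoʳ-≤ ρ (≤-trans (≤-reflexive (cong length (sym eq)))
                   (length-fibre-concat x 𝓔 (proj₁ ∘ large))))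

Hits : ∀ {n} → List (Fin n) → List (Fin n) → Set
Hits Y E = ∃[ y ] (y ∈ Y × y ∈ E)

module _ {n : ℕ} (ρ u : ℕ) (0<u : 0 < u) (0<ρ : 0 < ρ) (n≤ρu : n ≤ ρ * u) where

  -- While more than half of `𝓔` remains, a popular element of the remainder removes at least
  -- `length 𝓔 / (2 * ρ)` sets. The last alternative records `t` such removals with denominators
  -- cleared.
  greedy-steps : ∀ t (𝓔 : List (List (Fin n))) → (∀ {E} → E ∈ 𝓔 → Large u E) →
    ∃₂ λ Y 𝓡 → length Y ≤ t × (∀ {E} → E ∈ 𝓡 → Large u E) ×
      (∀ {E} → E ∈ 𝓔 → Hits Y E ⊎ E ∈ 𝓡) ×
      (2 * length 𝓡 ≤ length 𝓔 ⊎ t * length 𝓔 + ρ * (2 * length 𝓡) ≤ ρ * (2 * length 𝓔))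
  greedy-steps zero 𝓔 large = [] , 𝓔 , z≤n , large , inj₂ , inj₂ ≤-refl
  greedy-steps (suc t) 𝓔 large with greedy-steps t 𝓔 large
  ... | Y , 𝓡 , Y≤t , large𝓡 , cover , progress with 2 * length 𝓡 ≤? length 𝓔
  ...   | yes half = Y , 𝓡 , m≤n⇒m≤1+n Y≤t , large𝓡 , cover , inj₁ half
  ...   | no ¬half with popular-element ρ u 𝓡 0<u 0<ρ n≤ρu large𝓡 (nonempty 𝓡 ¬half)
    where
    nonempty : ∀ (𝓡 : List (List (Fin n))) → ¬ (2 * length 𝓡 ≤ length 𝓔) → 0 < length 𝓡
    nonempty [] ¬h = contradiction z≤n ¬h
    nonempty (_ ∷ _) _ = z<s
  ...     | x , popular =
    x ∷ Y , filter (¬? ∘ (x ∈?_)) 𝓡 , s≤s Y≤t ,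
    (λ E∈ → large𝓡 (proj₁ (∈-filter⁻ (¬? ∘ (x ∈?_)) E∈))) , cover′ , inj₂ (begin
      (P + t * P) + ρ * (2 * r′)     ≡⟨ +-assoc P (t * P) _ ⟩
      P + (t * P + ρ * (2 * r′))     ≤⟨ +-monoˡ-≤ _ (<⇒≤ (≰⇒> ¬half)) ⟩
      2 * r + (t * P + ρ * (2 * r′)) ≤⟨ +-monoˡ-≤ _ (*-monoʳ-≤ 2 popular) ⟩
      2 * (ρ * h) + (t * P + ρ * (2 * r′)) ≡⟨ arith ρ h (t * P) r′ ⟩
      t * P + ρ * (2 * (h + r′))     ≡⟨ cong (λ s → t * P + ρ * (2 * s)) (length-filter-¬ (x ∈?_) 𝓡) ⟩
      t * P + ρ * (2 * r)            ≤⟨ [ (λ half → contradiction half ¬half) , id ]′ progress ⟩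
      ρ * (2 * P)                    ∎)
    where
    open ≤-Reasoning
    P r r′ h : ℕ
    P = length 𝓔
    r = length 𝓡
    r′ = length (filter (¬? ∘ (x ∈?_)) 𝓡)
    h = length (filter (x ∈?_) 𝓡)
    arith : ∀ ρ h a r′ → 2 * (ρ * h) + (a + ρ * (2 * r′)) ≡ a + ρ * (2 * (h + r′))
    arith = solve-∀
    cover′ : ∀ {E} → E ∈ 𝓔 → Hits (x ∷ Y) E ⊎ E ∈ filter (¬? ∘ (x ∈?_)) 𝓡
    cover′ {E} E∈ with cover E∈
    ... | inj₁ (y , y∈Y , y∈E) = inj₁ (y , there y∈Y , y∈E)
    ... | inj₂ E∈𝓡 with x ∈? E
    ...   | yes x∈E = inj₁ (x , here refl , x∈E)
    ...   | no x∉E = inj₂ (∈-filter⁺ (¬? ∘ (x ∈?_)) E∈𝓡 x∉E)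

  -- A round of `ρ` greedy steps leaves at most half of the sets, so `k` rounds leave none.
  greedy-cover : ∀ k (𝓔 : List (List (Fin n))) → length 𝓔 < 2 ^ k →
    (∀ {E} → E ∈ 𝓔 → Large u E) →
    ∃[ Y ] (length Y ≤ k * ρ × (∀ {E} → E ∈ 𝓔 → Hits Y E))
  greedy-cover zero [] _ _ = [] , z≤n , λ ()
  greedy-cover zero (_ ∷ _) (s≤s ()) _
  greedy-cover (suc k) 𝓔 𝓔<2^k large with greedy-steps ρ 𝓔 large
  ... | Y , 𝓡 , Y≤ρ , large𝓡 , cover , progress
    with greedy-cover k 𝓡 (*-cancelˡ-< 2 _ _ (≤-<-trans half 𝓔<2^k)) large𝓡
    where
    open ≤-Reasoning
    half : 2 * length 𝓡 ≤ length 𝓔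
    -- After exactly `ρ` steps, counting the removals also shows that at most half is left.
    half = [ id , (λ le → *-cancelˡ-≤ ρ {{>-nonZero 0<ρ}} (+-cancelˡ-≤ (ρ * length 𝓔) _ _ (begin
      ρ * length 𝓔 + ρ * (2 * length 𝓡) ≤⟨ le ⟩
      ρ * (2 * length 𝓔)                ≡⟨ arith ρ (length 𝓔) ⟩
      ρ * length 𝓔 + ρ * length 𝓔       ∎))) ]′ progress
      where
      arith : ∀ a b → a * (2 * b) ≡ a * b + a * b
      arith = solve-∀
  ... | Y′ , Y′≤ , cover′ = Y ++ Y′ ,
    ≤-trans (≤-reflexive (length-++ Y)) (+-mono-≤ Y≤ρ Y′≤) ,
    λ E∈ → [ (λ (y , y∈Y , y∈E) → y , ∈-++⁺ˡ y∈Y , y∈E)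
           , (λ E∈𝓡 → let (y , y∈Y′ , y∈E) = cover′ E∈𝓡 in y , ∈-++⁺ʳ Y y∈Y′ , y∈E) ]′ (cover E∈)

  module _ {κ : ℕ} (w k : ℕ) (𝓕 : List (List (Vec (Fin n) (suc κ)))) (𝓕<2^k : length 𝓕 < 2 ^ k)
    (large : ∀ {F} → F ∈ 𝓕 → Unique (map head F) × u + w ≤ length F) where

    headIn? : ∀ X (K : Vec (Fin n) (suc κ)) → Dec (head K ∈ X)
    headIn? X K = head K ∈? X

    -- Families with enough heads already in X are dropped, and the others have lost fewer
    -- than w members, so the greedy cover still applies to what remains of them.
    greedy-multicover : ∀ j → j ≤ w →
      ∃[ X ] (length X ≤ j * (k * ρ) × (∀ {F} → F ∈ 𝓕 → j ≤ length (filter (headIn? X) F)))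
    greedy-multicover zero _ = [] , z≤n , λ _ → z≤n
    greedy-multicover (suc j) j<w with greedy-multicover j (<⇒≤ j<w)
    ... | X , X≤ , hits
      with greedy-cover k (map rest 𝓢)
             (≤-<-trans (≤-trans (≤-reflexive (length-map rest 𝓢)) (length-filter short? 𝓕)) 𝓕<2^k)
             large-rest
      where
      short? : ∀ F → Dec (length (filter (headIn? X) F) < suc j)
      short? F = length (filter (headIn? X) F) <? suc j
      𝓢 : List (List (Vec (Fin n) (suc κ)))
      𝓢 = filter short? 𝓕
      rest : List (Vec (Fin n) (suc κ)) → List (Fin n)
      rest F = map head (filter (¬? ∘ headIn? X) F)
      large-rest : ∀ {E} → E ∈ map rest 𝓢 → Large u E
      large-rest E∈ with ∈-map⁻ rest E∈
      ... | F , F∈𝓢 , refl with ∈-filter⁻ short? {xs = 𝓕} F∈𝓢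
      ...   | F∈𝓕 , short with large F∈𝓕
      ...     | unique , size =
        AllPairsₚ.map⁺ (AllPairsₚ.filter⁺ (¬? ∘ headIn? X) (AllPairsₚ.map⁻ unique)) ,
        ≤-trans (+-cancelʳ-≤ w u _ (begin
          u + w    ≤⟨ size ⟩
          length F ≡⟨ sym (length-filter-¬ (headIn? X) F) ⟩
          length (filter (headIn? X) F) + length (filter (¬? ∘ headIn? X) F)
                   ≤⟨ +-monoˡ-≤ _ (<⇒≤ (≤-trans short j<w)) ⟩
          w + length (filter (¬? ∘ headIn? X) F)
                   ≡⟨ +-comm w _ ⟩
          length (filter (¬? ∘ headIn? X) F) + w ∎)) (≤-reflexive (sym (length-map head (filter (¬? ∘ headIn? X) F))))
        where open ≤-Reasoning
    ... | Y , Y≤ , cover = Y ++ X ,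
      ≤-trans (≤-reflexive (length-++ Y)) (+-mono-≤ Y≤ X≤) , hits′
      where
      hits′ : ∀ {F} → F ∈ 𝓕 → suc j ≤ length (filter (headIn? (Y ++ X)) F)
      hits′ {F} F∈ with length (filter (headIn? X) F) <? suc j
      ... | no ≮ = ≤-trans (≮⇒≥ ≮) (length-filter-mono (headIn? X) (headIn? (Y ++ X)) F (λ _ → ∈-++⁺ʳ Y))
      ... | yes short with cover (∈-map⁺ _ (∈-filter⁺ (λ F → length (filter (headIn? X) F) <? suc j) F∈ short))
      ...   | y , y∈Y , y∈E with ∈-map⁻ head y∈E
      ...     | K , K∈ , refl with ∈-filter⁻ (¬? ∘ headIn? X) {xs = F} K∈
      ...       | K∈F , ∉X = ≤-<-trans (hits F∈)
        (length-filter-mono-< (headIn? X) (headIn? (Y ++ X)) (λ _ → ∈-++⁺ʳ Y) K∈F ∉X (∈-++⁺ˡ y∈Y))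

-- Only entries at equal positions are compared: this makes heads distinct and passes to tails, as
-- the induction on the length requires.
Apart : ∀ {n κ} → Vec (Fin n) κ → Vec (Fin n) κ → Set
Apart K K′ = ∀ i → lookup K i ≢ lookup K′ i

-- The quotient `n / q` rounded down; as it is at least 1, rounding loses at most a factor of two.
division-scale : ∀ n q → 0 < q → q ≤ n → ∃[ ρ ] (0 < ρ × ρ * q ≤ n × n ≤ ρ * (2 * q))
division-scale n q@(suc _) _ q≤n = n / q , m≥n⇒m/n>0 q≤n , m/n*n≤m n q , (begin
  n                     ≡⟨ m≡m%n+[m/n]*n n q ⟩
  n % q + n / q * q     ≤⟨ +-monoˡ-≤ _ (≤-trans (m%n≤n n q) (m≤n*m q (n / q) {{>-nonZero (m≥n⇒m/n>0 q≤n)}})) ⟩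
  n / q * q + n / q * q ≡⟨ arith (n / q) q ⟩
  n / q * (2 * q)       ∎)
  where
  open ≤-Reasoning
  arith : ∀ a b → a * b + a * b ≡ a * (2 * b)
  arith = solve-∀

-- The factor in family size spent on one position. With `w = growth k D ^ κ`, the product
-- `growth k D * w` splits into `2 * (w * (k * D))` members for the greedy cover and `w` that may be
-- lost on the way.
growth : ℕ → ℕ → ℕ
growth k D = 1 + 2 * (k * D)

module _ {n : ℕ} (k D : ℕ) (0<kD : 0 < k * D) where

  -- Induction on κ: hit the heads of growth k D ^ κ members of every family, then treat the tails.
  hitting-families : ∀ κ (𝓕 : List (List (Vec (Fin n) κ))) → length 𝓕 < 2 ^ k →
    (∀ {F} → F ∈ 𝓕 → AllPairs Apart F × growth k D ^ κ ≤ length F) →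
    growth k D ^ κ * (k * D) ≤ n →
    ∃[ T ] (length T * D ≤ κ * n × (∀ {F} → F ∈ 𝓕 → ∃[ K ] (K ∈ F × ∀ i → lookup K i ∈ T)))
  hitting-families zero 𝓕 _ large _ = [] , z≤n , λ F∈ → member (proj₂ (large F∈))
    where
    member : ∀ {F : List (Vec (Fin n) 0)} → 1 ≤ length F → ∃[ K ] (K ∈ F × ∀ i → lookup K i ∈ [])
    member {K ∷ _} _ = K , here refl , λ ()
  hitting-families (suc κ) 𝓕 𝓕<2^k large small
    -- With `w = growth k D ^ κ`, `ρ` is `n / (w * (k * D))` up to a factor of two. Its upper bound
    -- makes `w * (k * ρ) * D ≤ n`, the price of one position; its lower bound is what the greedy
    -- cover needs.
    with division-scale n (growth k D ^ κ * (k * D))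
           (*-mono-≤ {1} {growth k D ^ κ} {1} (m^n>0 (growth k D) κ) 0<kD)
           (≤-trans (*-monoˡ-≤ (k * D) (m≤n*m (growth k D ^ κ) (growth k D))) small)
  ... | ρ , 0<ρ , ρwkD≤n , n≤ρu
    with greedy-multicover ρ (2 * (growth k D ^ κ * (k * D)))
           (*-mono-≤ {1} {2} (s≤s z≤n) (*-mono-≤ {1} {growth k D ^ κ} {1} (m^n>0 (growth k D) κ) 0<kD)) 0<ρ n≤ρu
           (growth k D ^ κ) k 𝓕 𝓕<2^k
           (λ F∈ → AllPairsₚ.map⁺ (AllPairs.map (λ {K} {K′} → apart-head {K} {K′}) (proj₁ (large F∈))) ,
             ≤-trans (≤-reflexive (arith (growth k D ^ κ) (k * D))) (proj₂ (large F∈)))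
           (growth k D ^ κ) ≤-refl
    where
    apart-head : ∀ {K K′ : Vec (Fin n) (suc κ)} → Apart K K′ → head K ≢ head K′
    apart-head {_ ∷ _} {_ ∷ _} apart = apart fzero
    arith : ∀ w q → 2 * (w * q) + w ≡ (1 + 2 * q) * w
    arith = solve-∀
  ... | X , X≤ , hits
    -- Only members whose head is already in `X` are kept; each family retains enough of them for
    -- the induction.
    with hitting-families κ (map tails 𝓕) (≤-<-trans (≤-reflexive (length-map tails 𝓕)) 𝓕<2^k) large-tails
           (≤-trans (*-monoˡ-≤ (k * D) (m≤n*m (growth k D ^ κ) (growth k D))) small)
    where
    headIn : ∀ (K : Vec (Fin n) (suc κ)) → Dec (head K ∈ X)
    headIn K = head K ∈? X
    tails : List (Vec (Fin n) (suc κ)) → List (Vec (Fin n) κ)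
    tails F = map tail (filter headIn F)
    apart-tail : ∀ {K K′ : Vec (Fin n) (suc κ)} → Apart K K′ → Apart (tail K) (tail K′)
    apart-tail {_ ∷ _} {_ ∷ _} apart i = apart (fsuc i)
    large-tails : ∀ {F} → F ∈ map tails 𝓕 → AllPairs Apart F × growth k D ^ κ ≤ length F
    large-tails F∈ with ∈-map⁻ tails F∈
    ... | F , F∈𝓕 , refl =
      AllPairsₚ.map⁺ (AllPairsₚ.filter⁺ headIn (AllPairs.map (λ {K} {K′} → apart-tail {K} {K′}) (proj₁ (large F∈𝓕)))) ,
      ≤-trans (hits F∈𝓕) (≤-reflexive (sym (length-map tail (filter headIn F))))
  ... | T , T≤ , contained = X ++ T , (begin
      length (X ++ T) * D                   ≡⟨ cong (_* D) (length-++ X) ⟩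
      (length X + length T) * D             ≡⟨ *-distribʳ-+ D (length X) _ ⟩
      length X * D + length T * D           ≤⟨ +-mono-≤ (*-monoˡ-≤ D X≤) T≤ ⟩
      growth k D ^ κ * (k * ρ) * D + κ * n      ≡⟨ cong (_+ κ * n) (arith (growth k D ^ κ) k ρ D) ⟩
      ρ * (growth k D ^ κ * (k * D)) + κ * n    ≤⟨ +-monoˡ-≤ _ ρwkD≤n ⟩
      n + κ * n                             ∎) , contained′
    where
    open ≤-Reasoning
    arith : ∀ w k ρ D → w * (k * ρ) * D ≡ ρ * (w * (k * D))
    arith = solve-∀
    contained′ : ∀ {F} → F ∈ 𝓕 → ∃[ K ] (K ∈ F × ∀ i → lookup K i ∈ X ++ T)
    contained′ F∈ with contained (∈-map⁺ _ F∈)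
    ... | K′ , K′∈ , K′⊆T with ∈-map⁻ tail K′∈
    ...   | x ∷ K , K∈ , refl with ∈-filter⁻ (λ K → head K ∈? X) K∈
    ...     | K∈F , x∈X = x ∷ K , K∈F , λ where
      fzero    → ∈-++⁺ˡ x∈X
      (fsuc i) → ∈-++⁺ʳ X (K′⊆T i)

-- Padding lists to vectors of fixed length

toVec : ∀ {A : Set} κ → A → List A → Vec A κ
toVec zero    d xs       = []
toVec (suc κ) d []       = d ∷ toVec κ d []
toVec (suc κ) d (x ∷ xs) = x ∷ toVec κ d xs

lookup-toVec : ∀ {A : Set} κ {d : A} xs i → lookup (toVec κ d xs) i ∈ d ∷ xs
lookup-toVec (suc κ) []       fzero    = here refl
lookup-toVec (suc κ) []       (fsuc i) = lookup-toVec κ [] i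
lookup-toVec (suc κ) (x ∷ xs) fzero    = there (here refl)
lookup-toVec (suc κ) (x ∷ xs) (fsuc i) with lookup-toVec κ xs i
... | here e   = here e
... | there y∈ = there (there y∈)

∈-toVec : ∀ {A : Set} κ {d : A} xs → length xs ≤ κ → ∀ {x} → x ∈ xs → ∃[ i ] lookup (toVec κ d xs) i ≡ x
∈-toVec (suc κ) (x ∷ xs) _         (here refl) = fzero , refl
∈-toVec (suc κ) (x ∷ xs) (s≤s len) (there x∈)  with ∈-toVec κ xs len x∈
... | i , e = fsuc i , e

-- Supplies the padding from the list itself, so that a padded clique acquires no foreign element.
headOr : ∀ {A : Set} → A → List A → A
headOr d []      = d
headOr d (x ∷ _) = x

headOr-∈ : ∀ {A : Set} {d : A} {xs} → 0 < length xs → ∀ {x} → x ∈ headOr d xs ∷ xs → x ∈ xs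
headOr-∈ {xs = _ ∷ _} _ (here refl) = here refl
headOr-∈              _ (there x∈)  = x∈

-- Subsets as lists

elems : ∀ {n} → Subset n → List (Fin n)
elems []            = []
elems (inside ∷ S)  = fzero ∷ map fsuc (elems S)
elems (outside ∷ S) = map fsuc (elems S)

length-elems : ∀ {n} (S : Subset n) → length (elems S) ≡ ∣ S ∣
length-elems []            = refl
length-elems (inside ∷ S)  = cong suc (trans (length-map fsuc (elems S)) (length-elems S))
length-elems (outside ∷ S) = trans (length-map fsuc (elems S)) (length-elems S)

∈-elems⁺ : ∀ {n} {S : Subset n} {i} → i ∈ₛ S → i ∈ elems S
∈-elems⁺ {S = inside ∷ S}  here       = here refl
∈-elems⁺ {S = inside ∷ S}  (there i∈) = there (∈-map⁺ fsuc (∈-elems⁺ i∈))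
∈-elems⁺ {S = outside ∷ S} (there i∈) = ∈-map⁺ fsuc (∈-elems⁺ i∈)

∈-elems⁻ : ∀ {n} {S : Subset n} {i} → i ∈ elems S → i ∈ₛ S
∈-elems⁻ {S = inside ∷ S} (here refl) = here
∈-elems⁻ {S = inside ∷ S} (there i∈) with ∈-map⁻ fsuc i∈
... | _ , j∈ , refl = there (∈-elems⁻ j∈)
∈-elems⁻ {S = outside ∷ S} i∈ with ∈-map⁻ fsuc i∈
... | _ , j∈ , refl = there (∈-elems⁻ j∈)

elems-unique : ∀ {n} (S : Subset n) → Unique (elems S)
elems-unique []            = []
elems-unique (inside ∷ S)  =
  All.tabulate (λ i∈ e → fzero∉ (subst (_∈ map fsuc (elems S)) (sym e) i∈))
  ∷ Uniqueₚ.map⁺ fsuc-injective (elems-unique S)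
  where
  fzero∉ : fzero ∉ map fsuc (elems S)
  fzero∉ i∈ with ∈-map⁻ fsuc i∈
  ... | _ , _ , ()
elems-unique (outside ∷ S) = Uniqueₚ.map⁺ fsuc-injective (elems-unique S)

fromList : ∀ {n} → List (Fin n) → Subset n
fromList []       = ⊥
fromList (x ∷ xs) = ⁅ x ⁆ ∪ fromList xs

∈-fromList⁺ : ∀ {n} {xs : List (Fin n)} {i} → i ∈ xs → i ∈ₛ fromList xs
∈-fromList⁺ {xs = x ∷ xs} (here refl) = x∈p∪q⁺ (inj₁ (x∈⁅x⁆ x))
∈-fromList⁺ {xs = x ∷ xs} (there i∈)  = x∈p∪q⁺ (inj₂ (∈-fromList⁺ i∈))

∈-fromList⁻ : ∀ {n} (xs : List (Fin n)) {i} → i ∈ₛ fromList xs → i ∈ xs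
∈-fromList⁻ []       i∈ = ⊥-elim (∉⊥ i∈)
∈-fromList⁻ (x ∷ xs) i∈ with x∈p∪q⁻ ⁅ x ⁆ (fromList xs) i∈
... | inj₁ i∈x  = here (x∈⁅y⁆⇒x≡y x i∈x)
... | inj₂ i∈xs = there (∈-fromList⁻ xs i∈xs)

∣fromList∣-≤ : ∀ {n} (xs : List (Fin n)) → ∣ fromList xs ∣ ≤ length xs
∣fromList∣-≤ xs = ≤-trans (≤-reflexive (sym (length-elems (fromList xs))))
  (length-unique-≤ (elems-unique (fromList xs)) (∈-fromList⁻ xs ∘ ∈-elems⁻))

∣fromList∣-≥ : ∀ {n} {xs : List (Fin n)} → Unique xs → length xs ≤ ∣ fromList xs ∣
∣fromList∣-≥ {xs = xs} u = ≤-trans (length-unique-≤ u (∈-elems⁺ ∘ ∈-fromList⁺))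
  (≤-reflexive (length-elems (fromList xs)))

-- Least elements of finite total preorders

least : ∀ {A : Set} {R : A → A → Set} → (∀ {x y z} → R x y → R y z → R x z) →
  ∀ xs → 0 < length xs → (∀ {x y} → x ∈ xs → y ∈ xs → R x y ⊎ R y x) →
  ∃[ x ] (x ∈ xs × ∀ {y} → y ∈ xs → R x y)
least R-trans (x ∷ []) _ total = x , here refl , λ where
  -- Reflexivity at `x` is totality applied to `x` twice.
  (here refl) → [ id , id ]′ (total (here refl) (here refl))
least R-trans (x ∷ xs@(_ ∷ _)) _ total
  with least R-trans xs z<s (λ x∈ y∈ → total (there x∈) (there y∈))
... | y , y∈ , min with total (here refl) (there y∈)
... | inj₁ Rxy = x , here refl , λ where
  (here refl) → [ id , id ]′ (total (here refl) (here refl))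
  (there z∈)  → R-trans Rxy (min z∈)
... | inj₂ Ryx = y , there y∈ , λ where
  (here refl) → Ryx
  (there z∈)  → min z∈

argmin : ∀ {A : Set} (f : A → ℕ) (xs : List A) → 0 < length xs →
  ∃[ x ] (x ∈ xs × ∀ {y} → y ∈ xs → f x ≤ f y)
argmin f xs 0<len = least ≤-trans xs 0<len (λ _ _ → ≤-total _ _)

-- Maximum independent sets and neighbourhoods of chords

module _ {n : ℕ} (D : ChordDiagram n) where

  l r : Fin n → ℕ
  l = left D
  r = right D

  record MaximumList (S : List (Fin n)) : Set where
    field
      unique      : Unique S
      independent : ∀ {i j} → i ∈ S → j ∈ S → ¬ Cross D i j
      maximum     : ∀ {S′} → Unique S′ → (∀ {i j} → i ∈ S′ → j ∈ S′ → ¬ Cross D i j) →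
                    length S′ ≤ length S

  open MaximumList

  maximumList : ∀ {S} → MaximumIndependent D S → MaximumList (elems S)
  maximumList {S} (ind , max) = record
    { unique      = elems-unique S
    ; independent = λ i∈ j∈ → ind _ _ (∈-elems⁻ i∈) (∈-elems⁻ j∈)
    ; maximum     = λ {S′} u ind′ → begin
        length S′          ≤⟨ ∣fromList∣-≥ u ⟩
        ∣ fromList S′ ∣    ≤⟨ max (fromList S′) (λ i j i∈ j∈ → ind′ (∈-fromList⁻ S′ i∈) (∈-fromList⁻ S′ j∈)) ⟩
        ∣ S ∣              ≡⟨ sym (length-elems S) ⟩
        length (elems S)   ∎
    }
    where open ≤-Reasoning

  Transversal : List (Fin n) → Set
  Transversal T = ∀ {S} → MaximumList S → ∃[ i ] (i ∈ T × i ∈ S)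

  transversal⇒hittingSet : ∀ {T} → Transversal T → HittingSet D (fromList T)
  transversal⇒hittingSet trans S max with trans (maximumList max)
  ... | i , i∈T , i∈S = i , ∈-fromList⁺ i∈T , ∈-elems⁻ i∈S

  cross-sym : ∀ {i j} → Cross D i j → Cross D j i
  cross-sym (inj₁ c) = inj₂ c
  cross-sym (inj₂ c) = inj₁ c

  cross-irrefl : ∀ {i} → ¬ Cross D i i
  cross-irrefl (inj₁ (l<l , _)) = <-irrefl refl l<l
  cross-irrefl (inj₂ (l<l , _)) = <-irrefl refl l<l

  Starts? : ∀ v w → Dec (l v < l w × l w < r v)
  Starts? v w = (l v <? l w) ×-dec (l w <? r v)

  Ends? : ∀ v w → Dec (l v < r w × r w < r v)
  Ends? v w = (l v <? r w) ×-dec (r w <? r v)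

  -- Chords nested strictly inside `v` are included too, so this contains the closed neighbourhood.
  -- Counting endpoints inside the span is what adds up well over disjoint spans.
  starts ends neighbourhood : Fin n → List (Fin n)
  starts v = filter (Starts? v) (allFin n)
  ends v = filter (Ends? v) (allFin n)
  neighbourhood v = v ∷ starts v ++ ends v

  cross⇒∈-neighbourhood : ∀ {v w} → Cross D v w → w ∈ neighbourhood v
  cross⇒∈-neighbourhood {v} {w} (inj₁ (lv<lw , lw<rv , _)) =
    there (∈-++⁺ˡ (∈-filter⁺ (Starts? v) (∈-allFin w) (lv<lw , lw<rv)))
  cross⇒∈-neighbourhood {v} {w} (inj₂ (_ , lv<rw , rw<rv)) =
    there (∈-++⁺ʳ (starts v) (∈-filter⁺ (Ends? v) (∈-allFin w) (lv<rw , rw<rv)))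

  -- If `S` missed it, `v` could be added to `S`, contradicting maximality.
  neighbourhood-transversal : ∀ v → Transversal (neighbourhood v)
  neighbourhood-transversal v {S} max with any? (_∈? neighbourhood v) S
  ... | yes some with find some
  ...   | i , i∈S , i∈N = i , i∈N , i∈S
  neighbourhood-transversal v {S} max | no none =
    contradiction (maximum max (All.tabulate v≢ ∷ unique max) ind) (<⇒≱ (n<1+n (length S)))
    where
    v≢ : ∀ {i} → i ∈ S → v ≢ i
    v≢ i∈ refl = none (lose i∈ (here refl))
    ¬cross : ∀ {i} → i ∈ S → ¬ Cross D v i
    ¬cross i∈ c = none (lose i∈ (cross⇒∈-neighbourhood c))
    ind : ∀ {i j} → i ∈ v ∷ S → j ∈ v ∷ S → ¬ Cross D i j
    ind (here refl) (here refl) = cross-irrefl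
    ind (here refl) (there j∈)  = ¬cross j∈
    ind (there i∈)  (here refl) = ¬cross i∈ ∘ cross-sym
    ind (there i∈)  (there j∈)  = independent max i∈ j∈

  -- Over disjoint spans each left endpoint and each right endpoint is counted at most once, giving
  -- `n + n` in total, and each chord adds one for itself. Some chord is at most average.
  sparse-neighbourhood : ∀ vs → AllPairs (λ v w → r v ≤ l w) vs → 0 < length vs →
    ∃[ v ] length vs * length (neighbourhood v) ≤ length vs + (n + n)
  sparse-neighbourhood vs sorted 0<m
    with below-average (λ v → length (starts v ++ ends v)) vs 0<m
  ... | v , _ , avg = v , (begin
    m * suc (length (starts v ++ ends v))   ≡⟨ *-suc m _ ⟩
    m + m * length (starts v ++ ends v)     ≤⟨ +-monoʳ-≤ m avg ⟩
    m + sum (map (λ v → length (starts v ++ ends v)) vs)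
                                            ≤⟨ +-monoʳ-≤ m (split vs) ⟩
    m + (length (concat (map starts vs)) + length (concat (map ends vs)))
      ≤⟨ +-monoʳ-≤ m (+-mono-≤
           (length-unique-Fin (unique-concat-map starts (λ v → Uniqueₚ.filter⁺ (Starts? v) (Uniqueₚ.allFin⁺ n))
             (AllPairs.map disjoint-starts sorted)))
           (length-unique-Fin (unique-concat-map ends (λ v → Uniqueₚ.filter⁺ (Ends? v) (Uniqueₚ.allFin⁺ n))
             (AllPairs.map disjoint-ends sorted)))) ⟩
    m + (n + n)                             ∎)
    where
    open ≤-Reasoning
    m : ℕ
    m = length vs
    disjoint-starts : ∀ {v w} → r v ≤ l w → Disjoint (starts v) (starts w)
    disjoint-starts {v} {w} rv≤lw (x∈v , x∈w) = <-irrefl refl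
      (<-≤-trans (proj₂ (proj₂ (∈-filter⁻ (Starts? v) {xs = allFin n} x∈v)))
        (≤-trans rv≤lw (<⇒≤ (proj₁ (proj₂ (∈-filter⁻ (Starts? w) {xs = allFin n} x∈w))))))
    disjoint-ends : ∀ {v w} → r v ≤ l w → Disjoint (ends v) (ends w)
    disjoint-ends {v} {w} rv≤lw (x∈v , x∈w) = <-irrefl refl
      (<-≤-trans (proj₂ (proj₂ (∈-filter⁻ (Ends? v) {xs = allFin n} x∈v)))
        (≤-trans rv≤lw (<⇒≤ (proj₁ (proj₂ (∈-filter⁻ (Ends? w) {xs = allFin n} x∈w))))))
    arith : ∀ a b c d → (a + b) + (c + d) ≡ (a + c) + (b + d)
    arith = solve-∀
    split : ∀ vs → sum (map (λ v → length (starts v ++ ends v)) vs) ≤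
      length (concat (map starts vs)) + length (concat (map ends vs))
    split [] = z≤n
    split (v ∷ vs) = begin
      length (starts v ++ ends v) + sum (map (λ v → length (starts v ++ ends v)) vs)
        ≤⟨ +-mono-≤ (≤-reflexive (length-++ (starts v))) (split vs) ⟩
      (length (starts v) + length (ends v)) + (length (concat (map starts vs)) + length (concat (map ends vs)))
        ≡⟨ arith (length (starts v)) (length (ends v)) _ _ ⟩
      (length (starts v) + length (concat (map starts vs))) + (length (ends v) + length (concat (map ends vs)))
        ≡⟨ cong₂ _+_ (sym (length-++ (starts v))) (sym (length-++ (ends v))) ⟩
      length (concat (map starts (v ∷ vs))) + length (concat (map ends (v ∷ vs))) ∎

  -- Greedy stabbing of the intervals [l v, r v].

  -- `seg x` is the index of the segment containing position `x`; `separated` says that some cut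
  -- falls within the span.
  record Segmentation (m g : ℕ) : Set where
    field
      seg       : ℕ → ℕ
      bounded   : ∀ x → seg x < m
      mono      : ∀ {x y} → x ≤ y → seg x ≤ seg y
      separated : ∀ {v} → g ≤ l v → seg (l v) < seg (r v)

  -- Cut at the smallest right endpoint among chords starting at or after `g`. The chord attaining
  -- it joins the disjoint family; any other such chord is separated by this cut or starts beyond it
  -- and is left to the recursion.
  disjoint-or-segmented : ∀ m g →
    (∃[ vs ] (length vs ≡ m × (∀ {v} → v ∈ vs → g ≤ l v) × AllPairs (λ v w → r v ≤ l w) vs))
    ⊎ Segmentation m g
  disjoint-or-segmented zero g = inj₁ ([] , refl , (λ ()) , [])
  disjoint-or-segmented (suc m) g with filter (λ v → g ≤? l v) (allFin n) in eq
  ... | [] = inj₂ record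
    { seg = λ _ → 0 ; bounded = λ _ → z<s ; mono = λ _ → z≤n
    ; separated = λ {v} g≤ → contradiction
        (subst (v ∈_) eq (∈-filter⁺ (λ v → g ≤? l v) (∈-allFin v) g≤)) λ () }
  ... | ws@(_ ∷ _) with argmin r ws z<s
  ...   | u , u∈ , min with disjoint-or-segmented m (r u)
  ...     | inj₁ (vs , len , beyond , sorted) = inj₁
    (u ∷ vs , cong suc len , beyond′ , All.tabulate beyond ∷ sorted)
    where
    g≤lu : g ≤ l u
    g≤lu = proj₂ (∈-filter⁻ (λ v → g ≤? l v) {xs = allFin n} (subst (u ∈_) (sym eq) u∈))
    beyond′ : ∀ {v} → v ∈ u ∷ vs → g ≤ l v
    beyond′ (here refl) = g≤lu
    beyond′ (there v∈)  = ≤-trans (≤-trans g≤lu (<⇒≤ (ordered D u))) (beyond v∈)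
  ...     | inj₂ σ = inj₂ record { seg = seg′ ; bounded = bounded′ ; mono = mono′ ; separated = separated′ }
    where
    open Segmentation σ
    seg′ : ℕ → ℕ
    seg′ x with r u ≤? x
    ... | yes _ = suc (seg x)
    ... | no _  = 0
    bounded′ : ∀ x → seg′ x < suc m
    bounded′ x with r u ≤? x
    ... | yes _ = s≤s (bounded x)
    ... | no _  = z<s
    mono′ : ∀ {x y} → x ≤ y → seg′ x ≤ seg′ y
    mono′ {x} {y} x≤y with r u ≤? x | r u ≤? y
    ... | yes _    | yes _    = s≤s (mono x≤y)
    ... | yes ru≤x | no ru≰y  = contradiction (≤-trans ru≤x x≤y) ru≰y
    ... | no _     | _        = z≤n
    separated′ : ∀ {v} → g ≤ l v → seg′ (l v) < seg′ (r v)
    separated′ {v} g≤lv with r u ≤? l v | r u ≤? r v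
    ... | yes ru≤lv | yes _ = s≤s (separated ru≤lv)
    ... | no _      | yes _ = z<s
    ... | _         | no ru≰rv = contradiction
      (min (subst (v ∈_) eq (∈-filter⁺ (λ v → g ≤? l v) (∈-allFin v) g≤lv))) ru≰rv

  -- Chords nested between two chords o and c

  infix 4 _⊑_ _⊏_

  -- Reverse inclusion of spans, so that outer chords come first in a chain.
  _⊑_ _⊏_ : Fin n → Fin n → Set
  v ⊑ w = l v ≤ l w × r w ≤ r v
  v ⊏ w = v ⊑ w × v ≢ w

  ⊑-trans : ∀ {u v w} → u ⊑ v → v ⊑ w → u ⊑ w
  ⊑-trans (a , b) (c , d) = ≤-trans a c , ≤-trans d b

  ⊑-antisym : ∀ {v w} → v ⊑ w → w ⊑ v → v ≡ w
  ⊑-antisym (a , b) (c , d) = distinct D _ _ (≤-antisym a c) (≤-antisym d b)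

  ⊏-trans : ∀ {u v w} → u ⊏ v → v ⊏ w → u ⊏ w
  ⊏-trans (u⊑v , u≢v) (v⊑w , _) = ⊑-trans u⊑v v⊑w , λ where refl → u≢v (⊑-antisym u⊑v v⊑w)

  _⊏?_ : ∀ v w → Dec (v ⊏ w)
  v ⊏? w = ((l v ≤? l w) ×-dec (r w ≤? r v)) ×-dec ¬? (v ≟ᶠ w)

  ⊑⇒¬cross : ∀ {v w} → v ⊑ w → ¬ Cross D v w
  ⊑⇒¬cross (_ , rw≤rv) (inj₁ (_ , _ , rv<rw)) = <⇒≱ rv<rw rw≤rv
  ⊑⇒¬cross (lv≤lw , _) (inj₂ (lw<lv , _)) = <⇒≱ lw<lv lv≤lw

  -- Overlapping spans of which neither contains the other have strictly interleaved endpoints.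
  ¬cross⇒comparable : ∀ {v w} → ¬ Cross D v w → l v < r w → l w < r v → v ⊑ w ⊎ w ⊑ v
  ¬cross⇒comparable {v} {w} ¬c lv<rw lw<rv with l v ≤? l w | r w ≤? r v | l w ≤? l v | r v ≤? r w
  ... | yes a | yes b | _     | _     = inj₁ (a , b)
  ... | _     | _     | yes a | yes b = inj₂ (a , b)
  ... | no a  | _     | no b  | _     = contradiction (<⇒≤ (≰⇒> a)) b
  ... | _     | no a  | _     | no b  = contradiction (<⇒≤ (≰⇒> a)) b
  ... | yes _ | no b  | no c  | yes _ = contradiction (inj₁ (≰⇒> c , lw<rv , ≰⇒> b)) ¬c
  ... | no a  | yes _ | yes _ | no d  = contradiction (inj₂ (≰⇒> a , lv<rw , ≰⇒> d)) ¬c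

  module Box (o c : Fin n) where

    InBox : Fin n → Set
    InBox v = o ⊑ v × v ⊑ c

    InBox? : ∀ v → Dec (InBox v)
    InBox? v = ((l o ≤? l v) ×-dec (r v ≤? r o)) ×-dec ((l v ≤? l c) ×-dec (r c ≤? r v))

    box-overlap : ∀ {v w} → InBox v → InBox w → l v < r w
    box-overlap (_ , lv≤lc , _) (_ , _ , rc≤rw) = ≤-<-trans lv≤lc (<-≤-trans (ordered D c) rc≤rw)

    -- Layer k v: some ⊏-chain of k + 1 chords of the box ends at v.
    Layer : ℕ → Fin n → Set
    Layer zero    v = InBox v
    Layer (suc k) v = Layer k v × ∃[ w ] (Layer k w × w ⊏ v)

    Layer? : ∀ k v → Dec (Layer k v)
    Layer? zero    v = InBox? v
    Layer? (suc k) v = Layer? k v ×-dec anyᶠ? (λ w → Layer? k w ×-dec (w ⊏? v))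

    layer-antitone : ∀ {j k v} → j ≤ k → Layer k v → Layer j v
    layer-antitone {zero}  {zero}  _ λ₀ = λ₀
    layer-antitone {zero}  {suc k} _ (λₖ , _) = layer-antitone {zero} {k} z≤n λₖ
    layer-antitone {suc j} {suc k} (s≤s j≤k) (λₖ , w , λw , w⊏v) =
      layer-antitone j≤k λₖ , w , layer-antitone j≤k λw , w⊏v

    layer⇒box : ∀ k {v} → Layer k v → InBox v
    layer⇒box k = layer-antitone {zero} {k} z≤n

    chain : ∀ k {v} → Layer k v →
      ∃[ C ] (length C ≡ k × All (_⊏ v) C × AllPairs (λ x y → y ⊏ x) C × All InBox C)
    chain zero    _ = [] , refl , [] , [] , []
    chain (suc k) (_ , w , λw , w⊏v) with chain k λw
    ... | C , len , C⊏w , sorted , inBox =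
      w ∷ C , cong suc len , w⊏v ∷ All.map (λ x⊏w → ⊏-trans x⊏w w⊏v) C⊏w ,
      C⊏w ∷ sorted , layer⇒box k λw ∷ inBox

    full-chain : ∀ k {v} → Layer k v →
      ∃[ C ] (length C ≡ suc k × AllPairs (λ x y → y ⊏ x) C × All InBox C)
    full-chain k {v} λₖ with chain k λₖ
    ... | C , len , C⊏v , sorted , inBox = v ∷ C , cong suc len , C⊏v ∷ sorted , layer⇒box k λₖ ∷ inBox

    sorted⇒unique : ∀ {C} → AllPairs (λ x y → y ⊏ x) C → Unique C
    sorted⇒unique = AllPairs.map (λ (_ , y≢x) x≡y → y≢x (sym x≡y))

    -- The chain would consist of `n + 1` distinct chords.
    no-layer : ∀ {v} → ¬ Layer n v
    no-layer λₙ with full-chain n λₙ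
    ... | C , len , sorted , _ =
      <-irrefl refl (≤-trans (≤-reflexive (sym len)) (length-unique-Fin (sorted⇒unique sorted)))

    -- Decomposition of the box into levels by height

    Level : ℕ → Fin n → Set
    Level k v = Layer k v × ¬ Layer (suc k) v

    Level? : ∀ k v → Dec (Level k v)
    Level? k v = Layer? k v ×-dec ¬? (Layer? (suc k) v)

    level-unique : ∀ {j k v} → Level j v → Level k v → j ≡ k
    level-unique {j} {k} (λj , ¬j) (λk , ¬k) =
      ≤-antisym (≮⇒≥ (λ k<j → ¬k (layer-antitone k<j λj))) (≮⇒≥ (λ j<k → ¬j (layer-antitone j<k λk)))

    -- Non-crossing chords of the box are nested; were they distinct, a chain ending at the outer
    -- one would extend to the inner one and lift it to the next layer. This is Mirsky's
    -- decomposition, with antichains being cliques.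
    level-clique : ∀ {k v w} → Level k v → Level k w → ¬ Cross D v w → v ≡ w
    level-clique {k} {v} {w} (λv , ¬v) (λw , ¬w) ¬c with v ≟ᶠ w
    ... | yes v≡w = v≡w
    ... | no v≢w
      with ¬cross⇒comparable ¬c (box-overlap (layer⇒box k λv) (layer⇒box k λw))
                                (box-overlap (layer⇒box k λw) (layer⇒box k λv))
    ...   | inj₁ v⊑w = contradiction (λw , v , λv , v⊑w , v≢w) ¬w
    ...   | inj₂ w⊑v = contradiction (λv , w , λw , w⊑v , v≢w ∘ sym) ¬v

    last-true : ∀ {P : ℕ → Set} → Decidable P → ∀ m → P 0 → ¬ P m → ∃[ k ] (k < m × P k × ¬ P (suc k))
    last-true P? zero    p ¬p = contradiction p ¬p
    last-true P? (suc m) p ¬p with P? m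
    ... | yes pm = m , ≤-refl , pm , ¬p
    ... | no ¬pm with last-true P? m p ¬pm
    ...   | k , k<m , pk , ¬pk = k , m<n⇒m<1+n k<m , pk , ¬pk

    rank : Fin n → ℕ
    rank v with InBox? v
    ... | yes b = proj₁ (last-true (λ k → Layer? k v) n b no-layer)
    ... | no _  = 0

    rank-spec : ∀ {v} → InBox v → rank v < n × Level (rank v) v
    rank-spec {v} b with InBox? v
    ... | yes b′ = let (_ , k<n , λₖ , ¬λ) = last-true (λ k → Layer? k v) n b′ no-layer in k<n , λₖ , ¬λ
    ... | no ¬b  = contradiction b ¬b

    levelSet : ℕ → List (Fin n)
    levelSet k = filter (Level? k) (allFin n)

    ∈-levelSet⁺ : ∀ {k v} → Level k v → v ∈ levelSet k
    ∈-levelSet⁺ {k} = ∈-filter⁺ (Level? k) (∈-allFin _)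

    ∈-levelSet⁻ : ∀ {k v} → v ∈ levelSet k → Level k v
    ∈-levelSet⁻ {k} v∈ = proj₂ (∈-filter⁻ (Level? k) {xs = allFin n} v∈)

    module _ (leftGap : ∀ {v} → l o ≤ l v → ¬ (r v ≤ l c))
             (rightGap : ∀ {v} → r v ≤ r o → ¬ (r c ≤ l v)) where

      -- If `s` crossed `v`, then not crossing `o` would confine it to the span of `o`, a gap
      -- condition would forbid both its ends to lie on one side of `c`, and not crossing `c` would
      -- make it enclose `c`. So `s` would be in the box.
      outside⇒¬cross : ∀ {s v} → ¬ Cross D o s → ¬ Cross D c s → InBox v → ¬ InBox s → ¬ Cross D s v
      outside⇒¬cross {s} {v} ¬os ¬cs ((lo≤lv , rv≤ro) , (lv≤lc , rc≤rv)) ¬s (inj₁ (ls<lv , lv<rs , rs<rv)) =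
        ¬s ((lo≤ls , <⇒≤ rs<ro) , (<⇒≤ ls<lc , rc≤rs))
        where
        rs<ro : r s < r o
        rs<ro = <-≤-trans rs<rv rv≤ro
        ls<lc : l s < l c
        ls<lc = <-≤-trans ls<lv lv≤lc
        lo≤ls : l o ≤ l s
        lo≤ls = ≮⇒≥ (λ ls<lo → ¬os (inj₂ (ls<lo , ≤-<-trans lo≤lv lv<rs , rs<ro)))
        rc≤rs : r c ≤ r s
        rc≤rs = ≮⇒≥ (λ rs<rc → ¬cs (inj₂ (ls<lc , ≰⇒> (leftGap lo≤ls) , rs<rc)))
      outside⇒¬cross {s} {v} ¬os ¬cs ((lo≤lv , rv≤ro) , (lv≤lc , rc≤rv)) ¬s (inj₂ (lv<ls , ls<rv , rv<rs)) =
        ¬s ((<⇒≤ lo<ls , rs≤ro) , (ls≤lc , <⇒≤ rc<rs))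
        where
        lo<ls : l o < l s
        lo<ls = ≤-<-trans lo≤lv lv<ls
        rc<rs : r c < r s
        rc<rs = ≤-<-trans rc≤rv rv<rs
        rs≤ro : r s ≤ r o
        rs≤ro = ≮⇒≥ (λ ro<rs → ¬os (inj₁ (lo<ls , <-≤-trans ls<rv rv≤ro , ro<rs)))
        ls≤lc : l s ≤ l c
        ls≤lc = ≮⇒≥ (λ lc<ls → ¬cs (inj₁ (lc<ls , ≰⇒> (rightGap rs≤ro) , rc<rs)))

      -- If S missed a level, replacing its part in the box by a longest chain would enlarge it.
      meets-level : ∀ {S k v} → MaximumList S → o ∈ S → c ∈ S → Level k v → ∃[ s ] (s ∈ S × Level k s)
      meets-level {S} {k} {v} max o∈S c∈S (λv , _) with any? (Level? k) S
      ... | yes some = find some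
      -- `t` is the greatest height that occurs, so the chain `C` of `t + 1` chords is a longest
      -- one.
      ... | no none with last-true {λ j → ∃ (Layer j)} (λ j → anyᶠ? (Layer? j)) n
                           (v , layer⇒box k λv) (no-layer ∘ proj₂)
      ...   | t , _ , (x , λx) , ¬λ with full-chain t λx
      ...     | C , len , sorted , inBox = contradiction (≤-trans ranks-few chain-short) (<-irrefl refl)
        where
        open ≤-Reasoning
        out? : ∀ s → Dec (¬ InBox s)
        out? s = ¬? (InBox? s)
        in-S out-S : List (Fin n)
        in-S = filter InBox? S
        out-S = filter out? S
        C-independent : ∀ {i j} → i ∈ C → j ∈ C → ¬ Cross D i j
        C-independent i∈ j∈ cross with ∈-AllPairs₂ sorted i∈ j∈
        ... | inj₁ refl             = cross-irrefl cross
        ... | inj₂ (inj₁ (j⊑i , _)) = ⊑⇒¬cross j⊑i (cross-sym cross)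
        ... | inj₂ (inj₂ (i⊑j , _)) = ⊑⇒¬cross i⊑j cross
        out-C : ∀ {i j} → i ∈ out-S → j ∈ C → ¬ Cross D i j
        out-C i∈ j∈ with ∈-filter⁻ out? {xs = S} i∈
        ... | i∈S , ¬i = outside⇒¬cross (independent max o∈S i∈S) (independent max c∈S i∈S)
                           (All.lookup inBox j∈) ¬i
        disjoint : Disjoint out-S C
        disjoint (i∈ , i∈C) = proj₂ (∈-filter⁻ out? {xs = S} i∈) (All.lookup inBox i∈C)
        S′-independent : ∀ {i j} → i ∈ out-S ++ C → j ∈ out-S ++ C → ¬ Cross D i j
        S′-independent i∈ j∈ with ∈-++⁻ out-S i∈ | ∈-++⁻ out-S j∈
        ... | inj₁ i∈ | inj₁ j∈ = independent max (proj₁ (∈-filter⁻ out? i∈)) (proj₁ (∈-filter⁻ out? j∈))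
        ... | inj₁ i∈ | inj₂ j∈ = out-C i∈ j∈
        ... | inj₂ i∈ | inj₁ j∈ = out-C j∈ i∈ ∘ cross-sym
        ... | inj₂ i∈ | inj₂ j∈ = C-independent i∈ j∈
        -- `out-S ++ C` is independent, so by maximality `C` is no longer than the part of `S` it
        -- replaces.
        chain-short : suc t ≤ length in-S
        chain-short = +-cancelˡ-≤ (length out-S) _ _ (begin
          length out-S + suc t        ≡⟨ cong (length out-S +_) (sym len) ⟩
          length out-S + length C     ≡⟨ sym (length-++ out-S) ⟩
          length (out-S ++ C)         ≤⟨ maximum max (Uniqueₚ.++⁺ (Uniqueₚ.filter⁺ out? (unique max))
                                           (sorted⇒unique sorted) disjoint) S′-independent ⟩
          length S                    ≡⟨ sym (length-filter-¬ InBox? S) ⟩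
          length in-S + length out-S  ≡⟨ +-comm (length in-S) _ ⟩
          length out-S + length in-S  ∎)
        bound : ∀ {j s} → Layer j s → j < suc t
        bound λj = s≤s (≮⇒≥ (λ t<j → ¬λ (_ , layer-antitone t<j λj)))
        level-of : ∀ {s} → s ∈ in-S → s ∈ S × Level (rank s) s
        level-of s∈ with ∈-filter⁻ InBox? {xs = S} s∈
        ... | s∈S , b = s∈S , proj₂ (rank-spec b)
        -- The chords of `S` in the box have distinct ranks, all different from the missed `k` and
        -- at most `t`. Hence there are at most `t` of them, fewer than in `C`.
        ranks-unique : Unique (k ∷ map rank in-S)
        ranks-unique = All.tabulate k∉ ∷ unique-map rank (Uniqueₚ.filter⁺ InBox? (unique max)) inj
          where
          k∉ : ∀ {j} → j ∈ map rank in-S → k ≢ j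
          k∉ j∈ refl with ∈-map⁻ rank j∈
          ... | s , s∈ , k≡rank = let (s∈S , λs) = level-of s∈ in
            none (lose s∈S (subst (λ j → Level j s) (sym k≡rank) λs))
          inj : ∀ {s s′} → s ∈ in-S → s′ ∈ in-S → rank s ≡ rank s′ → s ≡ s′
          inj {s} {s′} s∈ s′∈ e = let (s∈S , λs) = level-of s∈ ; (s′∈S , λs′) = level-of s′∈ in
            level-clique λs (subst (λ j → Level j s′) (sym e) λs′) (independent max s∈S s′∈S)
        ranks-bounded : ∀ {j} → j ∈ k ∷ map rank in-S → j ∈ upTo (suc t)
        ranks-bounded (here refl) = ∈-upTo⁺ (bound λv)
        ranks-bounded (there j∈) with ∈-map⁻ rank j∈
        ... | s , s∈ , refl = ∈-upTo⁺ (bound (proj₁ (proj₂ (level-of s∈))))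
        ranks-few : suc (length in-S) ≤ suc t
        ranks-few = begin
          suc (length in-S)              ≡⟨ cong suc (sym (length-map rank in-S)) ⟩
          length (k ∷ map rank in-S)     ≤⟨ length-unique-≤ ranks-unique ranks-bounded ⟩
          length (upTo (suc t))          ≡⟨ length-upTo (suc t) ⟩
          suc t                          ∎

    -- Bounded levels as families of vectors

    Small : ℕ → ℕ → Set
    Small κ k = 0 < length (levelSet k) × length (levelSet k) ≤ κ

    Small? : ∀ κ k → Dec (Small κ k)
    Small? κ k = (0 <? length (levelSet k)) ×-dec (length (levelSet k) ≤? κ)

    smallLevels : ℕ → List ℕ
    smallLevels κ = filter (Small? κ) (upTo n)

    levelVec : ∀ κ → ℕ → Vec (Fin n) κ
    levelVec κ k = toVec κ (headOr o (levelSet k)) (levelSet k)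

    family : ∀ κ → List (Vec (Fin n) κ)
    family κ = map (levelVec κ) (smallLevels κ)

    lookup-levelVec : ∀ {κ k} → Small κ k → ∀ i → Level k (lookup (levelVec κ k) i)
    lookup-levelVec {κ} {k} (nonempty , _) i =
      ∈-levelSet⁻ (headOr-∈ nonempty (lookup-toVec κ (levelSet k) i))

    -- Distinct levels are disjoint, and each is padded only with its own chords.
    family-apart : ∀ κ → AllPairs Apart (family κ)
    family-apart κ = AllPairsₚ.map⁺ (allPairs-∈ (Uniqueₚ.filter⁺ (Small? κ) (Uniqueₚ.upTo⁺ n))
      λ {j} {k} j∈ k∈ j≢k i e → j≢k (level-unique
        (subst (Level j) e (lookup-levelVec (small j∈) i)) (lookup-levelVec (small k∈) i)))
      where
      small : ∀ {k} → k ∈ smallLevels κ → Small κ k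
      small k∈ = proj₂ (∈-filter⁻ (Small? κ) {xs = upTo n} k∈)

    -- The chords of `xs` occupy distinct levels. Each one on a level of more than `κ` chords uses
    -- up `suc κ` elements of `vs`, disjointly from the others; the remaining ones inject into the
    -- small levels.
    many-small-levels : ∀ κ {xs vs} → Unique xs → (∀ {v} → v ∈ xs → InBox v) →
      (∀ {v w} → v ∈ xs → w ∈ xs → ¬ Cross D v w) → (∀ {v} → InBox v → v ∈ vs) →
      suc κ * length xs ≤ length vs + suc κ * length (smallLevels κ)
    many-small-levels κ {xs} {vs} u inBox ind covered = begin
      suc κ * length xs                        ≡⟨ cong (suc κ *_) (sym (length-filter-¬ good? xs)) ⟩
      suc κ * (length good + length bad)       ≡⟨ arith (suc κ) (length good) (length bad) ⟩
      length bad * suc κ + suc κ * length good ≤⟨ +-mono-≤ bad-few (*-monoʳ-≤ (suc κ) good-few) ⟩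
      length vs + suc κ * length (smallLevels κ) ∎
      where
      open ≤-Reasoning
      arith : ∀ k g b → k * (g + b) ≡ b * k + k * g
      arith = solve-∀
      good? : ∀ v → Dec (length (levelSet (rank v)) ≤ κ)
      good? v = length (levelSet (rank v)) ≤? κ
      good bad : List (Fin n)
      good = filter good? xs
      bad = filter (¬? ∘ good?) xs
      rank-injective : ∀ {v w} → v ∈ xs → w ∈ xs → rank v ≡ rank w → v ≡ w
      rank-injective {w = w} v∈ w∈ e = level-clique (proj₂ (rank-spec (inBox v∈)))
        (subst (λ k → Level k w) (sym e) (proj₂ (rank-spec (inBox w∈)))) (ind v∈ w∈)
      good-few : length good ≤ length (smallLevels κ)
      good-few = ≤-trans (≤-reflexive (sym (length-map rank good)))
        (length-unique-≤ (unique-map rank (Uniqueₚ.filter⁺ good? u)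
          (λ v∈ w∈ → rank-injective (proj₁ (∈-filter⁻ good? v∈)) (proj₁ (∈-filter⁻ good? w∈)))) small)
        where
        small : ∀ {k} → k ∈ map rank good → k ∈ smallLevels κ
        small k∈ with ∈-map⁻ rank k∈
        ... | v , v∈ , refl with ∈-filter⁻ good? {xs = xs} v∈
        ...   | v∈xs , few = let (k<n , λv) = rank-spec (inBox v∈xs) in
          ∈-filter⁺ (Small? κ) (∈-upTo⁺ k<n) (∈-length (∈-levelSet⁺ λv) , few)
      bad-few : length bad * suc κ ≤ length vs
      bad-few = begin
        length bad * suc κ                             ≤⟨ length-concat-map-≥ (levelSet ∘ rank) bad
                                                            (λ v∈ → ≰⇒> (proj₂ (∈-filter⁻ (¬? ∘ good?) {xs = xs} v∈))) ⟩
        length (concat (map (levelSet ∘ rank) bad))    ≤⟨ length-unique-≤ levels-unique levels⊆vs ⟩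
        length vs                                      ∎
        where
        levels-unique : Unique (concat (map (levelSet ∘ rank) bad))
        levels-unique = unique-concat-map (levelSet ∘ rank)
          (λ v → Uniqueₚ.filter⁺ (Level? (rank v)) (Uniqueₚ.allFin⁺ n))
          (allPairs-∈ (Uniqueₚ.filter⁺ (¬? ∘ good?) u) λ v∈ w∈ v≢w (x∈v , x∈w) → v≢w
            (rank-injective (proj₁ (∈-filter⁻ (¬? ∘ good?) v∈)) (proj₁ (∈-filter⁻ (¬? ∘ good?) w∈))
              (level-unique (∈-levelSet⁻ x∈v) (∈-levelSet⁻ x∈w))))
        levels⊆vs : ∀ {x} → x ∈ concat (map (levelSet ∘ rank) bad) → x ∈ vs
        levels⊆vs x∈ with ∈-concat⁻′ (map (levelSet ∘ rank) bad) x∈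
        ... | ys , x∈ys , ys∈ with ∈-map⁻ (levelSet ∘ rank) ys∈
        ...   | v , _ , refl = covered (layer⇒box (rank v) (proj₁ (∈-levelSet⁻ x∈ys)))

  -- Rich pairs of chords in a maximum independent set

  record Window (κ q : ℕ) (S : List (Fin n)) : Set where
    field
      o c      : Fin n
      o∈       : o ∈ S
      c∈       : c ∈ S
      leftGap  : ∀ {v} → l o ≤ l v → ¬ (r v ≤ l c)
      rightGap : ∀ {v} → r v ≤ r o → ¬ (r c ≤ l v)
      rich     : q < suc κ * length (Box.smallLevels o c κ)

  -- By averaging, S is dense in the class of chords from segment i to segment j for some i and j.
  -- The chords of S in this class form a chain, and o and c are its two ends.
  window : ∀ {m κ q S} → Segmentation m 0 → MaximumList S →
    n + m * (m * q) < suc κ * length S → Window κ q S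
  window {m} {κ} {q} {S} σ max dense with
    -- The slack `m * q` kept for a left segment is divided among the `m` right segments by the
    -- second averaging, leaving `q`.
    dense-fibre (Segmentation.seg σ ∘ l) m (suc κ) (m * q) (allFin n) S
      (λ _ → Segmentation.bounded σ _) (λ _ → Segmentation.bounded σ _)
      (subst (λ a → a + m * (m * q) < suc κ * length S) (sym (length-allFin n)) dense)
  ... | i , denseᵢ with
    dense-fibre (Segmentation.seg σ ∘ r) m (suc κ) q
      (fibre (Segmentation.seg σ ∘ l) i (allFin n)) (fibre (Segmentation.seg σ ∘ l) i S)
      (λ _ → Segmentation.bounded σ _) (λ _ → Segmentation.bounded σ _) denseᵢ
  ... | j , denseⱼ = record
    { o = o ; c = c ; o∈ = proj₁ (members o∈) ; c∈ = proj₁ (members c∈)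
    -- Such a chord would have both ends in segment `i`, which `separated` excludes.
    ; leftGap = λ {v} lo≤lv rv≤lc → <⇒≱ (separated {v} z≤n) (begin
        seg (r v) ≤⟨ mono rv≤lc ⟩
        seg (l c) ≡⟨ trans (proj₁ (proj₂ (members c∈))) (sym (proj₁ (proj₂ (members o∈)))) ⟩
        seg (l o) ≤⟨ mono lo≤lv ⟩
        seg (l v) ∎)
    ; rightGap = λ {v} rv≤ro rc≤lv → <⇒≱ (separated {v} z≤n) (begin
        seg (r v) ≤⟨ mono rv≤ro ⟩
        seg (r o) ≡⟨ trans (proj₂ (proj₂ (members o∈))) (sym (proj₂ (proj₂ (members c∈)))) ⟩
        seg (r c) ≤⟨ mono rc≤lv ⟩
        seg (l v) ∎)
    -- `Vᵢⱼ` contains the whole box, so it can serve as `vs`; cancelling its length leaves the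
    -- surplus `q`.
    ; rich = +-cancelˡ-< (length Vᵢⱼ) _ _ (<-≤-trans denseⱼ (many-small-levels κ unique-Sᵢⱼ
        (λ v∈ → o-least v∈ , c-greatest v∈)
        (λ v∈ w∈ → independent max (proj₁ (members v∈)) (proj₁ (members w∈))) box⊆Vᵢⱼ))
    }
    where
    open ≤-Reasoning
    open Segmentation σ
    Vᵢⱼ Sᵢⱼ : List (Fin n)
    Vᵢⱼ = fibre (seg ∘ r) j (fibre (seg ∘ l) i (allFin n))
    Sᵢⱼ = fibre (seg ∘ r) j (fibre (seg ∘ l) i S)
    members : ∀ {v} → v ∈ Sᵢⱼ → v ∈ S × seg (l v) ≡ i × seg (r v) ≡ j
    members v∈ with ∈-filter⁻ (λ v → seg (r v) ≟ j) {xs = fibre (seg ∘ l) i S} v∈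
    ... | v∈′ , ej with ∈-filter⁻ (λ v → seg (l v) ≟ i) {xs = S} v∈′
    ...   | v∈S , ei = v∈S , ei , ej
    unique-Sᵢⱼ : Unique Sᵢⱼ
    unique-Sᵢⱼ = Uniqueₚ.filter⁺ (λ v → seg (r v) ≟ j) (Uniqueₚ.filter⁺ (λ v → seg (l v) ≟ i) (unique max))
    nonempty : 0 < length Sᵢⱼ
    nonempty = positive-factor (suc κ) (length Sᵢⱼ) denseⱼ
    i<j : ∀ {v w} → v ∈ Sᵢⱼ → w ∈ Sᵢⱼ → l v < r w
    i<j {v} {w} v∈ w∈ = ≰⇒> (λ rw≤lv → <⇒≱ (separated {v} z≤n) (begin
      seg (r v) ≡⟨ trans (proj₂ (proj₂ (members v∈))) (sym (proj₂ (proj₂ (members w∈)))) ⟩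
      seg (r w) ≤⟨ mono rw≤lv ⟩
      seg (l v) ∎))
    comparable : ∀ {v w} → v ∈ Sᵢⱼ → w ∈ Sᵢⱼ → v ⊑ w ⊎ w ⊑ v
    comparable v∈ w∈ = ¬cross⇒comparable (independent max (proj₁ (members v∈)) (proj₁ (members w∈)))
      (i<j v∈ w∈) (i<j w∈ v∈)
    outermost : ∃[ o ] (o ∈ Sᵢⱼ × ∀ {v} → v ∈ Sᵢⱼ → o ⊑ v)
    outermost = least ⊑-trans Sᵢⱼ nonempty comparable
    innermost : ∃[ c ] (c ∈ Sᵢⱼ × ∀ {v} → v ∈ Sᵢⱼ → v ⊑ c)
    innermost = least (λ u⊒v v⊒w → ⊑-trans v⊒w u⊒v) Sᵢⱼ nonempty (λ v∈ w∈ → comparable w∈ v∈)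
    o c : Fin n
    o = proj₁ outermost
    c = proj₁ innermost
    o∈ : o ∈ Sᵢⱼ
    o∈ = proj₁ (proj₂ outermost)
    c∈ : c ∈ Sᵢⱼ
    c∈ = proj₁ (proj₂ innermost)
    o-least : ∀ {v} → v ∈ Sᵢⱼ → o ⊑ v
    o-least = proj₂ (proj₂ outermost)
    c-greatest : ∀ {v} → v ∈ Sᵢⱼ → v ⊑ c
    c-greatest = proj₂ (proj₂ innermost)
    open Box o c using (many-small-levels; InBox)
    box⊆Vᵢⱼ : ∀ {v} → InBox v → v ∈ Vᵢⱼ
    box⊆Vᵢⱼ {v} ((lo≤lv , rv≤ro) , (lv≤lc , rc≤rv)) = ∈-filter⁺ (λ v → seg (r v) ≟ j)
      (∈-filter⁺ (λ v → seg (l v) ≟ i) (∈-allFin v) (≤-antisym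
        (≤-trans (mono lv≤lc) (≤-reflexive (proj₁ (proj₂ (members c∈)))))
        (≤-trans (≤-reflexive (sym (proj₁ (proj₂ (members o∈))))) (mono lo≤lv))))
      (≤-antisym
        (≤-trans (mono rv≤ro) (≤-reflexive (proj₂ (proj₂ (members o∈)))))
        (≤-trans (≤-reflexive (sym (proj₂ (proj₂ (members c∈))))) (mono rc≤rv)))

  -- Hitting the rich families of all pairs

  boxFamily : ∀ κ → Fin n × Fin n → List (Vec (Fin n) κ)
  boxFamily κ (o , c) = Box.family o c κ

  -- Ranges over all pairs, because `o` and `c` depend on the maximum independent set while `T` has
  -- to serve all of these at once.
  richFamilies : ∀ κ → ℕ → List (List (Vec (Fin n) κ))
  richFamilies κ U = filter (λ F → U ≤? length F) (map (boxFamily κ) (cartesianProduct (allFin n) (allFin n)))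

  length-richFamilies : ∀ κ U → length (richFamilies κ U) ≤ n * n
  length-richFamilies κ U = begin
    length (richFamilies κ U)                 ≤⟨ length-filter (λ F → U ≤? length F) (map (boxFamily κ) pairs) ⟩
    length (map (boxFamily κ) pairs)          ≡⟨ length-map (boxFamily κ) pairs ⟩
    length pairs                              ≡⟨ length-cartesianProduct (allFin n) (allFin n) ⟩
    length (allFin n) * length (allFin n)     ≡⟨ cong₂ _*_ (length-allFin n) (length-allFin n) ⟩
    n * n                                     ∎
    where
    open ≤-Reasoning
    pairs : List (Fin n × Fin n)
    pairs = cartesianProduct (allFin n) (allFin n)

  richFamilies-large : ∀ κ U {F} → F ∈ richFamilies κ U → AllPairs Apart F × U ≤ length F
  richFamilies-large κ U {F} F∈
    with ∈-filter⁻ (λ F → U ≤? length F) {xs = map (boxFamily κ) (cartesianProduct (allFin n) (allFin n))} F∈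
  ... | F∈map , size with ∈-map⁻ (boxFamily κ) {xs = cartesianProduct (allFin n) (allFin n)} F∈map
  ...   | (o , c) , _ , F≡ = subst (AllPairs Apart) (sym F≡) (Box.family-apart o c κ) , size

  -- `K` lists an entire level between `o` and `c`, and `S` meets that level by `meets-level`.
  family-hit : ∀ {κ q S T} → MaximumList S → (W : Window κ q S) →
    ∀ {K} → K ∈ Box.family (Window.o W) (Window.c W) κ → (∀ i → lookup K i ∈ T) → ∃[ i ] (i ∈ T × i ∈ S)
  family-hit {κ} {S = S} {T} max W {K} K∈ K⊆T
    with ∈-map⁻ (Box.levelVec (Window.o W) (Window.c W) κ) {xs = Box.smallLevels (Window.o W) (Window.c W) κ} K∈
  ... | j , j∈ , K≡ = hit (nonempty-∈ (proj₁ small-j))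
    where
    open Window W
    open Box o c
    small-j : Small κ j
    small-j = proj₂ (∈-filter⁻ (Small? κ) {xs = upTo n} j∈)
    hit : ∃ (_∈ levelSet j) → ∃[ i ] (i ∈ T × i ∈ S)
    hit (v , v∈) with meets-level leftGap rightGap max o∈ c∈ (∈-levelSet⁻ v∈)
    ... | s , s∈S , λs with ∈-toVec κ {d = headOr o (levelSet j)} (levelSet j) (proj₂ small-j) (∈-levelSet⁺ λs)
    ...   | i , e = s , subst (_∈ T) (trans (cong (λ K → lookup K i) K≡) e) (K⊆T i) , s∈S

  -- With `q = suc κ * U`, the field `rich` cancels to more than `U` small levels, so the family of
  -- the pair found in `S` is one of those that `T` serves.
  rich⇒transversal : ∀ {κ U T} →
    (∀ {F} → F ∈ richFamilies κ U → ∃[ K ] (K ∈ F × ∀ i → lookup K i ∈ T)) →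
    (∀ {S} → MaximumList S → Window κ (suc κ * U) S) → Transversal T
  rich⇒transversal {κ} {U} contained windows {S} max =
    let K , K∈ , K⊆T = contained {boxFamily κ (o , c)} rich-family in family-hit {q = suc κ * U} max W K∈ K⊆T
    where
    W : Window κ (suc κ * U) S
    W = windows {S} max
    open Window W
    rich-family : boxFamily κ (o , c) ∈ richFamilies κ U
    rich-family = ∈-filter⁺ (λ F → U ≤? length F)
      (∈-map⁺ (boxFamily κ) (∈-cartesianProduct⁺ (∈-allFin o) (∈-allFin c)))
      (≤-trans (<⇒≤ (*-cancelˡ-< (suc κ) _ _ rich))
        (≤-reflexive (sym (length-map (Box.levelVec o c κ) (Box.smallLevels o c κ)))))

  segmented-transversal : ∀ {m} κ k d → (0<kd : 0 < k * d) → Segmentation m 0 → n * n < 2 ^ k →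
    growth k d ^ κ * (k * d) ≤ n →
    (∀ {S} → MaximumList S → n + m * (m * (suc κ * growth k d ^ κ)) < suc κ * length S) →
    ∃[ T ] (length T * d ≤ κ * n × Transversal T)
  segmented-transversal κ k d 0<kd σ n²<2^k small dense =
    let T , T≤ , contained = hitting-families k d 0<kd κ (richFamilies κ U)
          (≤-<-trans (length-richFamilies κ U) n²<2^k) (richFamilies-large κ U) small
    in T , T≤ , rich⇒transversal contained (λ max → window σ max (dense max))
    where
    U : ℕ
    U = growth k d ^ κ

-- Logarithmic arithmetic

n<2^n : ∀ n → n < 2 ^ n
n<2^n zero    = z<s
n<2^n (suc n) = begin-strict
  1 + n           <⟨ +-mono-≤-< (m^n>0 2 n) (n<2^n n) ⟩
  2 ^ n + 2 ^ n   ≡⟨ cong (2 ^ n +_) (sym (+-identityʳ (2 ^ n))) ⟩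
  2 ^ suc n       ∎
  where open ≤-Reasoning

log₂-bracket : ∀ n → 0 < n → ∃[ e ] (2 ^ e ≤ n × n < 2 ^ suc e)
log₂-bracket (suc zero)    _ = 0 , ≤-refl , ≤-refl
log₂-bracket (suc n@(suc _)) _ with log₂-bracket n z<s
... | e , 2^e≤n , n<2^ with suc n <? 2 ^ suc e
...   | yes lt = e , m≤n⇒m≤1+n 2^e≤n , lt
...   | no ≮   = suc e , ≮⇒≥ ≮ , ≤-trans (s≤s n<2^) (≤-trans (+-monoˡ-≤ (2 ^ suc e) (m^n>0 2 (suc e)))
                   (≤-reflexive (cong (2 ^ suc e +_) (sym (+-identityʳ (2 ^ suc e))))))

^-distribʳ-* : ∀ n x y → (x * y) ^ n ≡ x ^ n * y ^ n
^-distribʳ-* zero    x y = refl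
^-distribʳ-* (suc n) x y = trans (cong (x * y *_) (^-distribʳ-* n x y)) (arith x y (x ^ n) (y ^ n))
  where
  arith : ∀ x y a b → x * y * (a * b) ≡ x * a * (y * b)
  arith = solve-∀

^-cancelˡ-≤ : ∀ i j → 2 ^ i ≤ 2 ^ j → i ≤ j
^-cancelˡ-≤ i j le = ≮⇒≥ (λ j<i → <⇒≱ (^-monoʳ-< 2 (s≤s (s≤s z≤n)) j<i) le)

-- Here `e` is `log n` rounded down, and `n ^ h ≤ 2 ^ (4 * n) ≤ e ^ (4 * n)`: the factor `log log n`
-- enters only through `2 ≤ e`.
boundLogLog : ∀ {n h} e → 2 ≤ e → 2 ^ e ≤ n → n < 2 ^ suc e → suc e * h ≤ 4 * n → BoundLogLog n h
boundLogLog {n} {h} e 2≤e 2^e≤n n<2^ℓ ℓh≤4n p q 0<q lt = ≰⇒> λ n^q≤2^p → <⇒≱ lt (begin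
  n ^ h * q ^ (4 * n)            ≤⟨ *-monoˡ-≤ (q ^ (4 * n)) (begin
      n ^ h                      ≤⟨ ^-monoˡ-≤ h (<⇒≤ n<2^ℓ) ⟩
      (2 ^ suc e) ^ h            ≡⟨ ^-*-assoc 2 (suc e) h ⟩
      2 ^ (suc e * h)            ≤⟨ ^-monoʳ-≤ 2 ℓh≤4n ⟩
      2 ^ (4 * n)                ≤⟨ ^-monoˡ-≤ (4 * n) 2≤e ⟩
      e ^ (4 * n)                ∎) ⟩
  e ^ (4 * n) * q ^ (4 * n)      ≡⟨ sym (^-distribʳ-* (4 * n) e q) ⟩
  (e * q) ^ (4 * n)              ≤⟨ ^-monoˡ-≤ (4 * n) (^-cancelˡ-≤ (e * q) p (begin
      2 ^ (e * q)                ≡⟨ sym (^-*-assoc 2 e q) ⟩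
      (2 ^ e) ^ q                ≤⟨ ^-monoˡ-≤ q 2^e≤n ⟩
      n ^ q                      ≤⟨ n^q≤2^p ⟩
      2 ^ p                      ∎)) ⟩
  p ^ (4 * n)                    ∎)
  where open ≤-Reasoning

-- With `q = suc e / j`, `suc e ≤ 2 ^ q * j` bounds the left side by `C * 2 ^ (2 * q * t)`. The
-- choice `j = 4 * t` keeps that exponent within half of `suc e`, and the rest of `e` absorbs
-- `C ≤ 2 ^ C`.
polynomial≤exponential : ∀ c t → 0 < t →
  ∃[ E ] (∀ e → E ≤ e → (c * (suc e * suc e)) ^ t ≤ 2 ^ e)
polynomial≤exponential c t@(suc _) _ = suc (2 * C) , bound
  where
  open ≤-Reasoning
  j C : ℕ
  j = 4 * t
  C = (c * (j * j)) ^ t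
  bound : ∀ e → suc (2 * C) ≤ e → (c * (suc e * suc e)) ^ t ≤ 2 ^ e
  bound e E≤e = begin
    (c * (suc e * suc e)) ^ t               ≤⟨ ^-monoˡ-≤ t (*-monoʳ-≤ c (*-mono-≤ ℓ≤ ℓ≤)) ⟩
    (c * ((2 ^ q * j) * (2 ^ q * j))) ^ t   ≡⟨ cong (_^ t) (arith₁ c (2 ^ q) j) ⟩
    (c * (j * j) * (2 ^ q * 2 ^ q)) ^ t     ≡⟨ ^-distribʳ-* t (c * (j * j)) (2 ^ q * 2 ^ q) ⟩
    C * (2 ^ q * 2 ^ q) ^ t                 ≡⟨ cong (λ x → C * x ^ t) (sym (^-distribˡ-+-* 2 q q)) ⟩
    C * (2 ^ (q + q)) ^ t                   ≡⟨ cong (C *_) (^-*-assoc 2 (q + q) t) ⟩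
    C * 2 ^ ((q + q) * t)                   ≤⟨ *-monoˡ-≤ (2 ^ ((q + q) * t)) (<⇒≤ (n<2^n C)) ⟩
    2 ^ C * 2 ^ ((q + q) * t)               ≡⟨ sym (^-distribˡ-+-* 2 C ((q + q) * t)) ⟩
    2 ^ (C + (q + q) * t)                   ≤⟨ ^-monoʳ-≤ 2 exponent ⟩
    2 ^ e                                   ∎
    where
    q : ℕ
    q = suc e / j
    arith₁ : ∀ c x j → c * ((x * j) * (x * j)) ≡ c * (j * j) * (x * x)
    arith₁ = solve-∀
    arith₂ : ∀ C q t → 2 * (C + (q + q) * t) ≡ 2 * C + q * (4 * t)
    arith₂ = solve-∀
    ℓ≤ : suc e ≤ 2 ^ q * j
    ℓ≤ = begin
      suc e               ≡⟨ m≡m%n+[m/n]*n (suc e) j ⟩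
      suc e % j + q * j   ≤⟨ +-monoˡ-≤ (q * j) (m%n≤n (suc e) j) ⟩
      suc q * j           ≤⟨ *-monoˡ-≤ j (n<2^n q) ⟩
      2 ^ q * j           ∎
    exponent : C + (q + q) * t ≤ e
    exponent = *-cancelˡ-≤ 2 (begin
      2 * (C + (q + q) * t)   ≡⟨ arith₂ C q t ⟩
      2 * C + q * j           ≤⟨ +-monoʳ-≤ (2 * C) (m/n*n≤m (suc e) j) ⟩
      2 * C + suc e           ≡⟨ +-suc (2 * C) e ⟩
      suc (2 * C) + e         ≤⟨ +-monoˡ-≤ e E≤e ⟩
      e + e                   ≡⟨ cong (e +_) (sym (+-identityʳ e)) ⟩
      2 * e                   ∎)

-- The dichotomy and the final bound

small-transversal : ∀ b e {n} (D : ChordDiagram n) k → 0 < b → n ≤ k * b →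
  (9 * b * (suc e * suc e)) ^ suc (2 * b) ≤ n → e < n → n < 2 ^ suc e →
  IndependenceNumber D k → ∃[ T ] (suc e * length T ≤ 4 * n × Transversal D T)
small-transversal b@(suc b′) e {n} D k _ n≤kb large e<n n<2^ℓ (S₀ , max₀ , ∣S₀∣≡k)
  with disjoint-or-segmented D (suc e) 0
... | inj₁ (vs , len , _ , sorted) =
  let v , deg = sparse-neighbourhood D vs sorted (subst (0 <_) (sym len) z<s)
  in neighbourhood D v , (begin
       suc e * length (neighbourhood D v)       ≡⟨ cong (_* length (neighbourhood D v)) (sym len) ⟩
       length vs * length (neighbourhood D v)   ≤⟨ deg ⟩
       -- There are `suc e ≤ n` chords in `vs`, so the total is at most `3 * n`.
       length vs + (n + n)                      ≤⟨ +-monoˡ-≤ (n + n) (≤-trans (≤-reflexive len) e<n) ⟩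
       n + (n + n)                              ≤⟨ m≤m+n (n + (n + n)) n ⟩
       n + (n + n) + n                          ≡⟨ arith n ⟩
       4 * n                                    ∎) , neighbourhood-transversal D v
  where
  open ≤-Reasoning
  arith : ∀ n → n + (n + n) + n ≡ 4 * n
  arith = solve-∀
... | inj₂ σ =
  -- The `n * n` pairs call for `2 * ℓ` halvings, and the divisor `κ * ℓ` offsets the factor `κ`
  -- lost over the positions.
  let T , T≤ , transversal = segmented-transversal D κ (ℓ + ℓ) (κ * ℓ) (s≤s z≤n) σ n²<2^2ℓ scale dense
  in T , ≤-trans (*-cancelˡ-≤ κ (begin
       κ * (ℓ * length T)    ≡⟨ trans (sym (*-assoc κ ℓ (length T))) (*-comm (κ * ℓ) (length T)) ⟩
       length T * (κ * ℓ)    ≤⟨ T≤ ⟩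
       κ * n                 ∎)) (m≤n*m n 4) , transversal
  where
  open ≤-Reasoning
  κ ℓ U : ℕ
  -- As `n ≤ k * b`, `suc κ * k` is at least `k + 2 * n`: one `n` outweighs all chords, the other
  -- pays for the slack of the averaging.
  κ = 2 * b
  ℓ = suc e
  U = growth (ℓ + ℓ) (κ * ℓ) ^ κ
  n²<2^2ℓ : n * n < 2 ^ (ℓ + ℓ)
  n²<2^2ℓ = <-≤-trans (*-mono-< n<2^ℓ n<2^ℓ) (≤-reflexive (sym (^-distribˡ-+-* 2 ℓ ℓ)))
  -- The product equals `8 * b * (ℓ * ℓ)`; one more `b * (ℓ * ℓ)` absorbs the `1`.
  growth≤ : growth (ℓ + ℓ) (κ * ℓ) ≤ 9 * b * (ℓ * ℓ)
  growth≤ = begin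
    1 + 2 * ((ℓ + ℓ) * (κ * ℓ))     ≤⟨ +-monoˡ-≤ (2 * ((ℓ + ℓ) * (κ * ℓ))) (s≤s z≤n) ⟩
    b * (ℓ * ℓ) + 2 * ((ℓ + ℓ) * (κ * ℓ)) ≡⟨ arith b ℓ ⟩
    9 * b * (ℓ * ℓ)                 ∎
    where
    arith : ∀ b ℓ → b * (ℓ * ℓ) + 2 * ((ℓ + ℓ) * (2 * b * ℓ)) ≡ 9 * b * (ℓ * ℓ)
    arith = solve-∀
  -- The second factor is below `growth`, so it costs one further power; hence the exponent `suc κ`.
  scale : U * ((ℓ + ℓ) * (κ * ℓ)) ≤ n
  scale = begin
    U * ((ℓ + ℓ) * (κ * ℓ))                   ≤⟨ *-monoʳ-≤ U (≤-trans (m≤n*m ((ℓ + ℓ) * (κ * ℓ)) 2) (n≤1+n _)) ⟩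
    U * growth (ℓ + ℓ) (κ * ℓ)                ≡⟨ *-comm U (growth (ℓ + ℓ) (κ * ℓ)) ⟩
    growth (ℓ + ℓ) (κ * ℓ) ^ suc κ            ≤⟨ ^-monoˡ-≤ (suc κ) growth≤ ⟩
    (9 * b * (ℓ * ℓ)) ^ suc κ                 ≤⟨ large ⟩
    n                                         ∎
  0<k : 0 < k
  0<k = positive-factor b k (<-≤-trans e<n (≤-trans n≤kb (≤-reflexive (*-comm k b))))
  dense : ∀ {S} → MaximumList D S → n + ℓ * (ℓ * (suc κ * U)) < suc κ * length S
  dense {S} max = begin-strict
    n + ℓ * (ℓ * (suc κ * U))                 ≤⟨ +-monoʳ-≤ n (begin
        ℓ * (ℓ * (suc κ * U))                 ≤⟨ *-monoʳ-≤ ℓ (*-monoʳ-≤ ℓ (*-monoˡ-≤ U (+-monoˡ-≤ κ {1} {κ} (s≤s z≤n)))) ⟩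
        ℓ * (ℓ * ((κ + κ) * U))               ≡⟨ arith₁ ℓ κ U ⟩
        U * ((ℓ + ℓ) * (κ * ℓ))               ≤⟨ scale ⟩
        n                                     ∎) ⟩
    n + n                                     <⟨ m<n+m (n + n) 0<k ⟩
    k + (n + n)                               ≤⟨ +-monoʳ-≤ k (+-mono-≤ n≤kb n≤kb) ⟩
    k + (k * b + k * b)                       ≡⟨ arith₂ k b ⟩
    suc κ * k                                 ≤⟨ *-monoʳ-≤ (suc κ) k≤ ⟩
    suc κ * length S                          ∎
    where
    arith₁ : ∀ ℓ κ U → ℓ * (ℓ * ((κ + κ) * U)) ≡ U * ((ℓ + ℓ) * (κ * ℓ))
    arith₁ = solve-∀
    arith₂ : ∀ k b → k + (k * b + k * b) ≡ suc (2 * b) * k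
    arith₂ = solve-∀
    S₀-list : MaximumList D (elems S₀)
    S₀-list = maximumList D max₀
    k≤ : k ≤ length S
    k≤ = ≤-trans (≤-reflexive (trans (sym ∣S₀∣≡k) (sym (length-elems S₀))))
      (MaximumList.maximum max (MaximumList.unique S₀-list) (MaximumList.independent S₀-list))

theorem4p1 : ∀ (a b : ℕ) → 0 < a → 0 < b →
    ∃[ N ] ∀ (n : ℕ) → N ≤ n → (D : ChordDiagram n) →
    (∃[ k ] (IndependenceNumber D k × k * b ≡ a * n)) →
    ∃[ T ] (HittingSet D T × BoundLogLog n ∣ T ∣)
theorem4p1 a@(suc _) b 0<a 0<b with polynomial≤exponential (9 * b) (suc (2 * b)) z<s
-- This threshold forces `2 + E ≤ e`, which serves both `poly≤exp` and the requirement `2 ≤ e` of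
-- `boundLogLog`.
... | E , poly≤exp = 2 ^ (2 + E) , λ n N≤n D (k , indep , kb≡an) →
  let e , 2^e≤n , n<2^ℓ = log₂-bracket n (≤-trans (m^n>0 2 (2 + E)) N≤n)
      2+E≤e = ≤-pred (≰⇒> λ ℓ≤2+E → <⇒≱ n<2^ℓ (≤-trans (^-monoʳ-≤ 2 ℓ≤2+E) N≤n))
      T , size , transversal = small-transversal b e D k 0<b
        -- Since `a` is at least 1, the density `a / b` is at least `1 / b`.
        (≤-trans (m≤n*m n a) (≤-reflexive (sym kb≡an)))
        (≤-trans (poly≤exp e (≤-trans (m≤n+m E 2) 2+E≤e)) 2^e≤n)
        (<-≤-trans (n<2^n e) 2^e≤n) n<2^ℓ indep
  in fromList T , transversal⇒hittingSet D transversal ,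
     boundLogLog e (≤-trans (m≤m+n 2 E) 2+E≤e) 2^e≤n n<2^ℓ
       (≤-trans (*-monoʳ-≤ (suc e) (∣fromList∣-≤ T)) size)
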